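{- Let $>$ be a ground-total reduction order and let $\Gamma\colon(\mathcal{E}_0,\mathcal{R}_0)\vdash_{\mathsf o}(\mathcal{E}_1,\mathcal{R}_1)\vdash_{\mathsf o}(\mathcal{E}_2,\mathcal{R}_2)\vdash_{\mathsf o}\cdots$ be an infinite run of ordered completion $\mathsf{KB_o}$ with respect to $>$, with $\mathcal{R}_0=\varnothing$. If $\Gamma$ is fair then $\mathcal{S}_\omega=\mathcal{E}_\omega^>\cup\mathcal{R}_\omega$ is ground-complete and the relations $\leftrightarrow_{\mathcal{E}_0}^*$ and $\leftrightarrow_{\mathcal{E}_\omega\cup\mathcal{R}_\omega}^*$ coincide.
   Context: Terms are built from a signature $\mathcal{F}$ and an infinite set of variables. An ES is a set of pairs of terms $s\approx t$; a TRS is a set of pairs $\ell\to r$ with $\ell$ not a variable and every variable of $r$ occurring in $\ell$. For a set $X$ of pairs of terms, $X^{\pm}=X\cup X^{ -1}$, $\to_X$ is the closure of $X$ under contexts and substitutions, $\leftrightarrow_X$ its symmetric closure, $\leftrightarrow_X^*$ the conversion relation, and $\downarrow_X\,=\,\to_X^*\cdot{}_X^*{\leftarrow}$ joinability. A reduction order is a well-founded strict order on terms closed under contexts and substitutions; it is ground-total if any two distinct ground terms are comparable. A TRS $\mathcal{R}$ is ground-complete if it is terminating and, for all ground terms $s,t$, $s\,{}_{\mathcal{R}}^*{\leftarrow}\cdot\to_{\mathcal{R}}^*t$ implies $s\downarrow_{\mathcal{R}}t$. For an ES $\mathcal{E}$, $\mathcal{E}^>$ is the set of rules $\ell\sigma\to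 r\sigma$ with $\ell\approx r\in\mathcal{E}^\pm$, $\sigma$ a substitution, and $\ell\sigma>r\sigma$. A term $s$ encompasses $t$ if $s=C[t\sigma]$ for some $C,\sigma$; properly, if moreover $t$ does not encompass $s$. Write $t\to^{\rhd}_{\mathcal{R}}u$ if $t\to u$ using a rule $\ell\to r\in\mathcal{R}$ with $t$ properly encompassing $\ell$, and $t\to^{\rhd}_{\mathcal{E}^>}u$ if there are $\ell\approx r\in\mathcal{E}^\pm$, $C$, $\sigma$ with $t=C[\ell\sigma]$, $u=C[r\sigma]$, $\ell\sigma>r\sigma$, and $t$ properly encompasses $\ell$. Inference system $\mathsf{KB_o}$ ($\uplus$ is disjoint union): $(\mathcal{E},\mathcal{R})\vdash_{\mathsf o}(\mathcal{E}',\mathcal{R}')$ if it is an instance of one of - deduce: $(\mathcal{E},\mathcal{R})\vdash(\mathcal{E}\cup\{s\approx t\},\mathcal{R})$ if $s\,{}_{\mathcal{R}\cup\mathcal{E}^\pm}{\leftarrow}\cdot\to_{\mathcal{R}\cup\mathcal{E}^\pm}t$; - orient: $(\mathcal{E}\uplus\{s\approx t\},\mathcal{R})\vdash(\mathcal{E},\mathcal{R}\cup\{s\to t\})$ if $s>t$, and $(\mathcal{E}\uplus\{s\approx t\},\mathcal{R})\vdash(\mathcal{E},\mathcal{R}\cup\{t\to s\})$ if $t>s$; - delete: $(\mathcal{E}\uplus\{s\approx s\},\mathcal{R})\vdash(\mathcal{E},\mathcal{R})$; - compose: $(\mathcal{E},\mathcal{R}\uplus\{s\to t\})\vdash(\mathcal{E},\mathcal{R}\cup\{s\to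 u\})$ if $t\to_{\mathcal{E}^>\cup\mathcal{R}}u$; - simplify: $(\mathcal{E}\uplus\{s\approx t\},\mathcal{R})\vdash(\mathcal{E}\cup\{u\approx t\},\mathcal{R})$ if $s\to_{\mathcal{R}}u$ or $s\to^{\rhd}_{\mathcal{E}^>}u$, and $(\mathcal{E}\uplus\{s\approx t\},\mathcal{R})\vdash(\mathcal{E}\cup\{s\approx u\},\mathcal{R})$ if $t\to_{\mathcal{R}}u$ or $t\to^{\rhd}_{\mathcal{E}^>}u$; - collapse: $(\mathcal{E},\mathcal{R}\uplus\{t\to s\})\vdash(\mathcal{E}\cup\{u\approx s\},\mathcal{R})$ if $t\to^{\rhd}_{\mathcal{R}}u$ or $t\to^{\rhd}_{\mathcal{E}^>}u$. For an infinite run put $\mathcal{E}_\infty=\bigcup_{i}\mathcal{E}_i$, $\mathcal{E}_\omega=\bigcup_{i}\bigcap_{j\ge i}\mathcal{E}_j$, $\mathcal{R}_\omega=\bigcup_{i}\bigcap_{j\ge i}\mathcal{R}_j$. Extended prime critical pairs: an extended overlap of an ES $\mathcal{E}$ is a triple $\langle\ell_1\approx r_1,p,\ell_2\approx r_2\rangle$ where both equations are variants (up to renaming) of equations in $\mathcal{E}^\pm$ without common variables, $p$ is a non-variable position of $\ell_2$, $\ell_1$ and $\ell_2|_p$ are unifiable with mgu $\mu$, $r_1\mu\not>\ell_1\mu$ and $r_2\mu\not>\ell_2\mu$. It gives the extended critical pair $\ell_2[r_1]_p\mu\approx r_2\mu$, which is prime if all proper subterms of $\ell_1\mu$ are $\mathcal{E}^>$-normal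 forms. $\mathrm{PCP}_>(\mathcal{E})$ is the set of extended prime critical pairs of $\mathcal{E}$ (rules of $\mathcal{R}_\omega$ are viewed as equations in $\mathcal{E}_\omega\cup\mathcal{R}_\omega$). The run is fair if $\mathrm{PCP}_>(\mathcal{E}_\omega\cup\mathcal{R}_\omega)\subseteq{\downarrow_{\mathcal{S}_\omega}}\cup{\leftrightarrow_{\mathcal{E}_\infty}}$. -}

module Defs where

open import Data.Fin using (Fin)
open import Data.List using (List)
open import Data.List.Membership.Propositional using (_∉_)
open import Data.Nat using (ℕ; suc; _≤_)
open import Data.Product using (Σ; ∃; _×_; _,_)
open import Data.Sum using (_⊎_)
open import Data.Vec using (Vec; []; _∷_; lookup; _[_]≔_)
open import Function using (flip; _∘_)
open import Function.Bundles using (_↔_; module Inverse)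
open import Induction.WellFounded using (WellFounded)
open import Level using (0ℓ)
open import Relation.Binary.Construct.Closure.Equivalence using (EqClosure)
open import Relation.Binary.Construct.Closure.ReflexiveTransitive using (Star)
open import Relation.Binary.Construct.Closure.Symmetric using (SymClosure)
open import Relation.Binary.Construct.Union using (_∪_)
open import Relation.Binary.Core using (Rel; _⇒_; _⇔_)
open import Relation.Binary.Rewriting using (IsNormalForm; StronglyNormalizing)
open import Relation.Binary.Structures using (IsStrictPartialOrder)
open import Relation.Binary.PropositionalEquality using (_≡_; _≢_)
open import Relation.Nullary using (¬_)

Infinite : Set → Set
Infinite A = (xs : List A) → ∃ λ x → x ∉ xs

record Signature : Set₁ where
  field
    Symbol : Set
    arity  : Symbol → ℕ

open Signature public

data Term (F : Signature) (V : Set) : Set where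
  var : V → Term F V
  app : (f : Symbol F) → Vec (Term F V) (arity F f) → Term F V

module _ {F : Signature} {V : Set} where

  infixl 30 _⟨_⟩ _⟨_⟩*
  infixl 25 _∣_
  infix  30 _[_]
  infix  4 _∈ᵥ_
  infix  30 _±

  data _∈ᵥ_ (x : V) : Term F V → Set where
    here  : x ∈ᵥ var x
    there : ∀ {f ts} (i : Fin (arity F f)) → x ∈ᵥ lookup ts i → x ∈ᵥ app f ts

  Ground : Term F V → Set
  Ground t = ∀ x → ¬ (x ∈ᵥ t)

  data NonVar : Term F V → Set where
    nonVar : ∀ {f ts} → NonVar (app f ts)

  Subst : Set
  Subst = V → Term F V

  mutual
    _⟨_⟩ : Term F V → Subst → Term F V
    var x    ⟨ σ ⟩ = σ x
    app f ts ⟨ σ ⟩ = app f (ts ⟨ σ ⟩*)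

    _⟨_⟩* : ∀ {n} → Vec (Term F V) n → Subst → Vec (Term F V) n
    []       ⟨ σ ⟩* = []
    (t ∷ ts) ⟨ σ ⟩* = t ⟨ σ ⟩ ∷ ts ⟨ σ ⟩*

  -- In inside f ts i C the hole of C sits below the i-th argument of f;
  -- the i-th entry of ts is overwritten on filling and hence irrelevant.
  data Context : Set where
    □      : Context
    inside : (f : Symbol F) → Vec (Term F V) (arity F f) → Fin (arity F f) →
             Context → Context

  _[_] : Context → Term F V → Term F V
  □               [ t ] = t
  inside f ts i C [ t ] = app f (ts [ i ]≔ C [ t ])

  data Position : Term F V → Set where
    root : ∀ {t} → Position t
    arg  : ∀ {f ts} (i : Fin (arity F f)) → Position (lookup ts i) →
           Position (app f ts)

  _∣_ : (t : Term F V) → Position t → Term F V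
  t        ∣ root    = t
  app f ts ∣ arg i p = lookup ts i ∣ p

  replaceAt : (t : Term F V) → Position t → Term F V → Term F V
  replaceAt t          root      u = u
  replaceAt (app f ts) (arg i p) u = app f (ts [ i ]≔ replaceAt (lookup ts i) p u)

  -- Sets of pairs of terms (equations or rules) are binary relations; their
  -- extensional equality is _⇔_.

  _±  : Rel (Term F V) 0ℓ → Rel (Term F V) 0ℓ
  X ± = SymClosure X

  ⁅_≈_⁆ : Term F V → Term F V → Rel (Term F V) 0ℓ
  ⁅ s ≈ t ⁆ u v = u ≡ s × v ≡ t

  record IsTRS (R : Rel (Term F V) 0ℓ) : Set where
    field
      lhs-nonVar : ∀ {l r} → R l r → NonVar l
      rhs-vars   : ∀ {l r} → R l r → ∀ {x} → x ∈ᵥ r → x ∈ᵥ l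

  data Step (X : Rel (Term F V) 0ℓ) (s t : Term F V) : Set where
    step : ∀ {l r} → X l r → (C : Context) (σ : Subst) →
           s ≡ C [ l ⟨ σ ⟩ ] → t ≡ C [ r ⟨ σ ⟩ ] → Step X s t

  Joinable : Rel (Term F V) 0ℓ → Rel (Term F V) 0ℓ
  Joinable X s t = ∃ λ u → Star (Step X) s u × Star (Step X) t u

  Conversion : Rel (Term F V) 0ℓ → Rel (Term F V) 0ℓ
  Conversion X = EqClosure (Step X)

  -- Termination in the sense of accessibility of every term.
  record GroundComplete (R : Rel (Term F V) 0ℓ) : Set where
    field
      isTRS           : IsTRS R
      terminating     : StronglyNormalizing (Step R)
      groundConfluent : ∀ {s t u} → Ground s → Ground t →
                        Star (Step R) u s → Star (Step R) u t → Joinable R s t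

  record IsReductionOrder (_>_ : Rel (Term F V) 0ℓ) : Set where
    field
      isStrictPartialOrder : IsStrictPartialOrder _≡_ _>_
      wellFounded          : WellFounded (flip _>_)
      context-closed       : ∀ {s t} (C : Context) → s > t → C [ s ] > C [ t ]
      subst-closed         : ∀ {s t} (σ : Subst) → s > t → s ⟨ σ ⟩ > t ⟨ σ ⟩

  GroundTotal : Rel (Term F V) 0ℓ → Set
  GroundTotal _>_ = ∀ {s t} → Ground s → Ground t → s ≢ t → s > t ⊎ t > s

  Encompasses : Rel (Term F V) 0ℓ
  Encompasses s t = Σ Context λ C → Σ Subst λ σ → s ≡ C [ t ⟨ σ ⟩ ]

  ProperlyEncompasses : Rel (Term F V) 0ℓ
  ProperlyEncompasses s t = Encompasses s t × ¬ Encompasses t s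

  Step▷ : Rel (Term F V) 0ℓ → Rel (Term F V) 0ℓ
  Step▷ R t u = Step (λ l r → R l r × ProperlyEncompasses t l) t u

  -- Variants are taken with respect to bijective renamings.
  Variant : Rel (Term F V) 0ℓ → Rel (Term F V) 0ℓ
  Variant X l′ r′ = ∃ λ l → ∃ λ r → X l r × Σ (V ↔ V) λ π →
    l′ ≡ l ⟨ var ∘ Inverse.to π ⟩ × r′ ≡ r ⟨ var ∘ Inverse.to π ⟩

  record IsMGU (μ : Subst) (s t : Term F V) : Set where
    field
      unifies     : s ⟨ μ ⟩ ≡ t ⟨ μ ⟩
      mostGeneral : ∀ σ → s ⟨ σ ⟩ ≡ t ⟨ σ ⟩ →
                    Σ Subst λ τ → ∀ x → σ x ≡ μ x ⟨ τ ⟩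

  ⋃ : (ℕ → Rel (Term F V) 0ℓ) → Rel (Term F V) 0ℓ
  ⋃ X s t = ∃ λ i → X i s t

  liminf : (ℕ → Rel (Term F V) 0ℓ) → Rel (Term F V) 0ℓ
  liminf X s t = ∃ λ i → ∀ j → i ≤ j → X j s t

  State : Set₁
  State = Rel (Term F V) 0ℓ × Rel (Term F V) 0ℓ

  _≋_ : State → State → Set
  (E , R) ≋ (E′ , R′) = (E ⇔ E′) × (R ⇔ R′)

  module _ (_>_ : Rel (Term F V) 0ℓ) where

    -- Ordered E is the set of rules usually written E with superscript >.
    data Ordered (E : Rel (Term F V) 0ℓ) (s t : Term F V) : Set where
      ordered : ∀ {l r} → (E ±) l r → (σ : Subst) →
                s ≡ l ⟨ σ ⟩ → t ≡ r ⟨ σ ⟩ → s > t → Ordered E s t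

    -- Here it is the uninstantiated l that t has to encompass properly.
    data OrderedStep▷ (E : Rel (Term F V) 0ℓ) (t u : Term F V) : Set where
      step : ∀ {l r} → (E ±) l r → (C : Context) (σ : Subst) →
             t ≡ C [ l ⟨ σ ⟩ ] → u ≡ C [ r ⟨ σ ⟩ ] → l ⟨ σ ⟩ > r ⟨ σ ⟩ →
             ProperlyEncompasses t l → OrderedStep▷ E t u

    infix 3 _⊢_

    -- A disjoint union with a singleton is a union whose premise says that
    -- the pair is absent from the remaining set.
    data _⊢_ : State → State → Set₁ where
      deduce    : ∀ {E R s t u} → Step (R ∪ E ±) u s → Step (R ∪ E ±) u t →
                  (E , R) ⊢ (E ∪ ⁅ s ≈ t ⁆ , R)
      orientˡ   : ∀ {E R s t} → ¬ E s t → s > t →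
                  (E ∪ ⁅ s ≈ t ⁆ , R) ⊢ (E , R ∪ ⁅ s ≈ t ⁆)
      orientʳ   : ∀ {E R s t} → ¬ E s t → t > s →
                  (E ∪ ⁅ s ≈ t ⁆ , R) ⊢ (E , R ∪ ⁅ t ≈ s ⁆)
      delete    : ∀ {E R s} → ¬ E s s →
                  (E ∪ ⁅ s ≈ s ⁆ , R) ⊢ (E , R)
      compose   : ∀ {E R s t u} → ¬ R s t → Step (Ordered E ∪ R) t u →
                  (E , R ∪ ⁅ s ≈ t ⁆) ⊢ (E , R ∪ ⁅ s ≈ u ⁆)
      simplifyˡ : ∀ {E R s t u} → ¬ E s t → Step R s u ⊎ OrderedStep▷ E s u →
                  (E ∪ ⁅ s ≈ t ⁆ , R) ⊢ (E ∪ ⁅ u ≈ t ⁆ , R)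
      simplifyʳ : ∀ {E R s t u} → ¬ E s t → Step R t u ⊎ OrderedStep▷ E t u →
                  (E ∪ ⁅ s ≈ t ⁆ , R) ⊢ (E ∪ ⁅ s ≈ u ⁆ , R)
      collapse  : ∀ {E R s t u} → ¬ R t s → Step▷ R t u ⊎ OrderedStep▷ E t u →
                  (E , R ∪ ⁅ t ≈ s ⁆) ⊢ (E ∪ ⁅ u ≈ s ⁆ , R)

    -- Inference steps act on sets, i.e. on states up to extensional equality.
    IsRun : (E R : ℕ → Rel (Term F V) 0ℓ) → Set₁
    IsRun E R = ∀ i → ∃ λ S → ∃ λ S′ →
      (E i , R i) ≋ S × (S ⊢ S′) × S′ ≋ (E (suc i) , R (suc i))

    record ExtendedOverlap (E : Rel (Term F V) 0ℓ) : Set where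
      field
        l₁ r₁ l₂ r₂ : Term F V
        variant₁ : Variant (E ±) l₁ r₁
        variant₂ : Variant (E ±) l₂ r₂
        disjoint : ∀ x → x ∈ᵥ l₁ ⊎ x ∈ᵥ r₁ → ¬ (x ∈ᵥ l₂ ⊎ x ∈ᵥ r₂)
        p        : Position l₂
        p-nonVar : NonVar (l₂ ∣ p)
        μ        : Subst
        mgu      : IsMGU μ l₁ (l₂ ∣ p)
        r₁≯l₁    : ¬ (r₁ ⟨ μ ⟩ > l₁ ⟨ μ ⟩)
        r₂≯l₂    : ¬ (r₂ ⟨ μ ⟩ > l₂ ⟨ μ ⟩)

      left right : Term F V
      left  = replaceAt l₂ p r₁ ⟨ μ ⟩
      right = r₂ ⟨ μ ⟩

      Prime : Set
      Prime = ∀ (q : Position (l₁ ⟨ μ ⟩)) → q ≢ root →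
              IsNormalForm (Step (Ordered E)) (l₁ ⟨ μ ⟩ ∣ q)

    PCP : Rel (Term F V) 0ℓ → Rel (Term F V) 0ℓ
    PCP E s t = Σ (ExtendedOverlap E) λ o → let open ExtendedOverlap o in
      Prime × s ≡ left × t ≡ right

    Sω : (E R : ℕ → Rel (Term F V) 0ℓ) → Rel (Term F V) 0ℓ
    Sω E R = Ordered (liminf E) ∪ liminf R

    Fair : (E R : ℕ → Rel (Term F V) 0ℓ) → Set
    Fair E R = PCP (liminf E ∪ liminf R) ⇒
               (Joinable (Sω E R) ∪ SymClosure (Step (⋃ E)))

{-# OPTIONS --safe #-}
-- Every equation or rule that disappears during the run is replaced by smaller
-- ones. Comparing an instance S ≈ T of s ≈ t by its larger side, then by s under
-- encompassment, then by its kind (rule or equation), then by its smaller side,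
-- one obtains by well-founded induction a conversion between S and T in the limit
-- system, each of whose terms is bounded by S or by T. This gives equality of the
-- conversion relations, and it turns the E∞-steps allowed by fairness into
-- conversions below the peak. For local confluence it suffices to compare an
-- arbitrary step u → t with a step u → v at an innermost redex, since two
-- arbitrary steps are then connected through v; critical pairs arising from
-- innermost redexes are prime. Finally, ground-totality orients every limit step
-- between distinct ground terms, and connectedness of the ground peaks below
-- their source implies confluence.
module Submission where

open import Axiom.ExcludedMiddle using (ExcludedMiddle)
open import Data.Empty using (⊥-elim)
open import Data.Fin using (zero; suc)
open import Data.Fin.Properties using () renaming (_≟_ to _≟ᶠ_)
open import Data.List using (List; []; _∷_; _++_; map; length; filter)
open import Data.List.Membership.Propositional using (_∈_; _∉_)
open import Data.List.Membership.Propositional.Properties using (∈-++⁺ˡ; ∈-++⁺ʳ; ∈-map⁺)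
open import Data.List.Properties using (map-++; filter-accept)
open import Data.List.Relation.Unary.All using (All; []; _∷_)
open import Data.List.Relation.Unary.All.Properties using (++⁺; ++⁻ˡ; ++⁻ʳ)
open import Data.List.Relation.Unary.Any using (here; there)
open import Data.Nat using (ℕ; zero; suc; _+_; _∸_; _≤_; _<_; z≤n; s≤s; s≤s⁻¹)
open import Data.Nat.Induction using (<-wellFounded)
open import Data.Nat.Properties hiding (_≟_)
open import Data.Product using (Σ; ∃; _×_; _,_; proj₁; proj₂)
open import Data.Product.Relation.Binary.Lex.Strict using (×-Lex; ×-wellFounded)
open import Data.Sum using (_⊎_; inj₁; inj₂; [_,_]′)
open import Data.Unit using (⊤; tt)
open import Data.Vec using (Vec; []; _∷_; head; tail; lookup; _[_]≔_)
open import Data.Vec.Properties using ([]≔-lookup; []≔-idempotent; []≔-commutes; lookup∘update; lookup∘update′)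
open import Function using (_∘_; flip; const)
open import Function.Bundles using (_↔_; module Inverse; mk↔ₛ′)
open import Function.Construct.Composition using (_↔-∘_)
open import Function.Construct.Identity using (↔-id)
open import Induction.WellFounded using (WellFounded; Acc; acc; module Subrelation)
open import Level using (0ℓ)
import Relation.Binary.Construct.Closure.Equivalence as Eq
open import Relation.Binary.Construct.Closure.ReflexiveTransitive as Star using (Star; ε; _◅_; _◅◅_)
open import Relation.Binary.Construct.Closure.Symmetric as Sym using (SymClosure; fwd; bwd)
open import Relation.Binary.Construct.Union using (_∪_)
open import Relation.Binary.Core using (Rel; _⇒_; _⇔_)
open import Relation.Binary.Definitions using (Empty)
open import Relation.Binary.PropositionalEquality hiding ([_])
open import Relation.Binary.Rewriting using (IsNormalForm)
open import Relation.Binary.Structures using (IsStrictPartialOrder)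
open import Relation.Nullary using (¬_; Dec; yes; no)
open import Defs

+-≡-split : ∀ {a b c d} → c ≤ a → d ≤ b → a + b ≡ c + d → a ≡ c × b ≡ d
+-≡-split {a} {b} {c} {d} c≤a d≤b eq =
  ≤-antisym (+-cancelʳ-≤ b a c (≤-trans (≤-reflexive eq) (+-monoʳ-≤ c d≤b))) c≤a ,
  ≤-antisym (+-cancelˡ-≤ a b d (≤-trans (≤-reflexive eq) (+-monoˡ-≤ d c≤a))) d≤b

-- Terms, substitutions, contexts and term size.

module _ {F : Signature} {V : Set} where

  infixl 25 _⊙_
  infixr 25 _∘ᶜ_
  infixl 30 _⟨_⟩ᶜ

  _⊙_ : Subst {F} {V} → Subst {F} {V} → Subst {F} {V}
  (σ ⊙ τ) x = σ x ⟨ τ ⟩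

  mutual
    ⟨⟩-⊙ : ∀ (t : Term F V) {σ τ} → t ⟨ σ ⟩ ⟨ τ ⟩ ≡ t ⟨ σ ⊙ τ ⟩
    ⟨⟩-⊙ (var x)    = refl
    ⟨⟩-⊙ (app f ts) = cong (app f) (⟨⟩*-⊙ ts)

    ⟨⟩*-⊙ : ∀ {n} (ts : Vec (Term F V) n) {σ τ} → ts ⟨ σ ⟩* ⟨ τ ⟩* ≡ ts ⟨ σ ⊙ τ ⟩*
    ⟨⟩*-⊙ []       = refl
    ⟨⟩*-⊙ (t ∷ ts) = cong₂ _∷_ (⟨⟩-⊙ t) (⟨⟩*-⊙ ts)

  mutual
    ⟨var⟩ : ∀ (t : Term F V) → t ⟨ var ⟩ ≡ t
    ⟨var⟩ (var x)    = refl
    ⟨var⟩ (app f ts) = cong (app f) (⟨var⟩* ts)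

    ⟨var⟩* : ∀ {n} (ts : Vec (Term F V) n) → ts ⟨ var ⟩* ≡ ts
    ⟨var⟩* []       = refl
    ⟨var⟩* (t ∷ ts) = cong₂ _∷_ (⟨var⟩ t) (⟨var⟩* ts)

  mutual
    ⟨⟩-cong : ∀ (t : Term F V) {σ τ : Subst} → (∀ x → x ∈ᵥ t → σ x ≡ τ x) →
              t ⟨ σ ⟩ ≡ t ⟨ τ ⟩
    ⟨⟩-cong (var x)    eq = eq x here
    ⟨⟩-cong (app f ts) eq = cong (app f) (⟨⟩*-cong ts (λ i x x∈ → eq x (there i x∈)))

    ⟨⟩*-cong : ∀ {n} (ts : Vec (Term F V) n) {σ τ : Subst} →
               (∀ i x → x ∈ᵥ lookup ts i → σ x ≡ τ x) → ts ⟨ σ ⟩* ≡ ts ⟨ τ ⟩*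
    ⟨⟩*-cong []       eq = refl
    ⟨⟩*-cong (t ∷ ts) eq = cong₂ _∷_ (⟨⟩-cong t (eq zero)) (⟨⟩*-cong ts (eq ∘ suc))

  lookup-⟨⟩* : ∀ {n} (ts : Vec (Term F V) n) {σ} i → lookup (ts ⟨ σ ⟩*) i ≡ lookup ts i ⟨ σ ⟩
  lookup-⟨⟩* (t ∷ ts) zero    = refl
  lookup-⟨⟩* (t ∷ ts) (suc i) = lookup-⟨⟩* ts i

  []≔-⟨⟩* : ∀ {n} (ts : Vec (Term F V) n) {σ} i {u} →
            (ts [ i ]≔ u) ⟨ σ ⟩* ≡ ts ⟨ σ ⟩* [ i ]≔ u ⟨ σ ⟩
  []≔-⟨⟩* (t ∷ ts) zero    = refl
  []≔-⟨⟩* (t ∷ ts) (suc i) = cong (_ ∷_) ([]≔-⟨⟩* ts i)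

  _∘ᶜ_ : Context {F} {V} → Context {F} {V} → Context {F} {V}
  □              ∘ᶜ D = D
  inside f ts i C ∘ᶜ D = inside f ts i (C ∘ᶜ D)

  ∘ᶜ-[] : ∀ C D {t : Term F V} → (C ∘ᶜ D) [ t ] ≡ C [ D [ t ] ]
  ∘ᶜ-[] □                D = refl
  ∘ᶜ-[] (inside f ts i C) D = cong (λ u → app f (ts [ i ]≔ u)) (∘ᶜ-[] C D)

  _⟨_⟩ᶜ : Context {F} {V} → Subst {F} {V} → Context {F} {V}
  □               ⟨ σ ⟩ᶜ = □
  inside f ts i C ⟨ σ ⟩ᶜ = inside f (ts ⟨ σ ⟩*) i (C ⟨ σ ⟩ᶜ)

  []-⟨⟩ : ∀ C {σ} {t : Term F V} → (C [ t ]) ⟨ σ ⟩ ≡ C ⟨ σ ⟩ᶜ [ t ⟨ σ ⟩ ]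
  []-⟨⟩ □                 = refl
  []-⟨⟩ (inside f ts i C) = cong (app f) (trans ([]≔-⟨⟩* ts i) (cong (_ [ i ]≔_) ([]-⟨⟩ C)))

  fill-instance : ∀ C D {ρ σ} (l : Term F V) →
                  C [ (D [ l ⟨ ρ ⟩ ]) ⟨ σ ⟩ ] ≡ (C ∘ᶜ D ⟨ σ ⟩ᶜ) [ l ⟨ ρ ⊙ σ ⟩ ]
  fill-instance C D l = trans (cong (C [_]) (trans ([]-⟨⟩ D) (cong (_ [_]) (⟨⟩-⊙ l))))
                              (sym (∘ᶜ-[] C _))

  contextAt : (t : Term F V) → Position t → Context {F} {V}
  contextAt t          root      = □
  contextAt (app f ts) (arg i p) = inside f ts i (contextAt (lookup ts i) p)

  contextAt-∣ : ∀ (t : Term F V) p → contextAt t p [ t ∣ p ] ≡ t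
  contextAt-∣ t          root      = refl
  contextAt-∣ (app f ts) (arg i p) =
    cong (app f) (trans (cong (ts [ i ]≔_) (contextAt-∣ (lookup ts i) p)) ([]≔-lookup ts i))

  contextAt≢□ : ∀ {t : Term F V} {p} → p ≢ root → contextAt t p ≢ □
  contextAt≢□ {p = root}    p≢ _ = p≢ refl
  contextAt≢□ {p = arg i p} _ ()

  ⟨⟩ᶜ≢□ : ∀ {C : Context {F} {V}} {σ} → C ≢ □ → C ⟨ σ ⟩ᶜ ≢ □
  ⟨⟩ᶜ≢□ {C = □}              C≢ _ = C≢ refl
  ⟨⟩ᶜ≢□ {C = inside f ts i C} _ ()

  replaceAt-⟨⟩ : ∀ (t : Term F V) p {r σ} → replaceAt t p r ⟨ σ ⟩ ≡ contextAt t p ⟨ σ ⟩ᶜ [ r ⟨ σ ⟩ ]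
  replaceAt-⟨⟩ t          root      = refl
  replaceAt-⟨⟩ (app f ts) (arg i p) =
    cong (app f) (trans ([]≔-⟨⟩* ts i) (cong (_ [ i ]≔_) (replaceAt-⟨⟩ (lookup ts i) p)))

  mutual
    -- An application counts two, so even a constant outweighs a variable: replacing a variable by
    -- anything but a variable increases the size.
    size : Term F V → ℕ
    size (var x)    = 1
    size (app f ts) = suc (suc (size* ts))

    size* : ∀ {n} → Vec (Term F V) n → ℕ
    size* []       = 0
    size* (t ∷ ts) = size t + size* ts

  0<size : ∀ (t : Term F V) → 0 < size t
  0<size (var x)    = s≤s z≤n
  0<size (app f ts) = s≤s z≤n

  size-lookup : ∀ {n} (ts : Vec (Term F V) n) i → size (lookup ts i) ≤ size* ts
  size-lookup (t ∷ ts) zero    = m≤m+n _ _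
  size-lookup (t ∷ ts) (suc i) = ≤-trans (size-lookup ts i) (m≤n+m _ _)

  size-[]≔ : ∀ {n} (ts : Vec (Term F V) n) i {u} → size u ≤ size* (ts [ i ]≔ u)
  size-[]≔ (t ∷ ts) zero    = m≤m+n _ _
  size-[]≔ (t ∷ ts) (suc i) = ≤-trans (size-[]≔ ts i) (m≤n+m _ _)

  size-fill : ∀ C {t : Term F V} → size t ≤ size (C [ t ])
  size-fill □                 = ≤-refl
  size-fill (inside f ts i C) = ≤-trans (size-fill C) (m≤n⇒m≤1+n (m≤n⇒m≤1+n (size-[]≔ ts i)))

  size-fill-< : ∀ {C} {t : Term F V} → C ≢ □ → size t < size (C [ t ])
  size-fill-< {□}               C≢ = ⊥-elim (C≢ refl)
  size-fill-< {inside f ts i C} _  = s≤s (m≤n⇒m≤1+n (≤-trans (size-fill C) (size-[]≔ ts i)))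

  mutual
    size-⟨⟩ : ∀ (t : Term F V) {σ} → size t ≤ size (t ⟨ σ ⟩)
    size-⟨⟩ (var x) {σ} = 0<size (σ x)
    size-⟨⟩ (app f ts)  = s≤s (s≤s (size*-⟨⟩ ts))

    size*-⟨⟩ : ∀ {n} (ts : Vec (Term F V) n) {σ} → size* ts ≤ size* (ts ⟨ σ ⟩*)
    size*-⟨⟩ []       = z≤n
    size*-⟨⟩ (t ∷ ts) = +-mono-≤ (size-⟨⟩ t) (size*-⟨⟩ ts)

  ∈ᵥ-app-size : ∀ {f ts x} (σ : Subst {F} {V}) → x ∈ᵥ app f ts → size (σ x) < size (app f ts ⟨ σ ⟩)
  size-∈ᵥ : ∀ {t : Term F V} {x} σ → x ∈ᵥ t → size (σ x) ≤ size (t ⟨ σ ⟩)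

  ∈ᵥ-app-size σ (there {ts = ts} i x∈) = s≤s (m≤n⇒m≤1+n (≤-trans (size-∈ᵥ σ x∈)
    (≤-trans (≤-reflexive (cong size (sym (lookup-⟨⟩* ts i)))) (size-lookup (ts ⟨ σ ⟩*) i))))

  size-∈ᵥ σ here         = ≤-refl
  size-∈ᵥ σ (there {ts = ts} i x∈) = <⇒≤ (∈ᵥ-app-size σ (there {ts = ts} i x∈))

  mutual
    vars : Term F V → List V
    vars (var x)    = x ∷ []
    vars (app f ts) = vars* ts

    vars* : ∀ {n} → Vec (Term F V) n → List V
    vars* []       = []
    vars* (t ∷ ts) = vars t ++ vars* ts

  vars*-lookup : ∀ {n} (ts : Vec (Term F V) n) i {x} → x ∈ vars (lookup ts i) → x ∈ vars* ts
  vars*-lookup (t ∷ ts) zero    x∈ = ∈-++⁺ˡ x∈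
  vars*-lookup (t ∷ ts) (suc i) x∈ = ∈-++⁺ʳ (vars t) (vars*-lookup ts i x∈)

  ∈-vars : ∀ {t : Term F V} {x} → x ∈ᵥ t → x ∈ vars t
  ∈-vars here                    = here refl
  ∈-vars (there {ts = ts} i x∈) = vars*-lookup ts i (∈-vars x∈)

  mutual
    vars-rename : ∀ (t : Term F V) (f : V → V) → vars (t ⟨ var ∘ f ⟩) ≡ map f (vars t)
    vars-rename (var x)    f = refl
    vars-rename (app g ts) f = vars*-rename ts f

    vars*-rename : ∀ {n} (ts : Vec (Term F V) n) (f : V → V) →
                   vars* (ts ⟨ var ∘ f ⟩*) ≡ map f (vars* ts)
    vars*-rename []       f = refl
    vars*-rename (t ∷ ts) f = trans (cong₂ _++_ (vars-rename t f) (vars*-rename ts f))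
                                    (sym (map-++ f (vars t) (vars* ts)))

  mutual
    ∈ᵥ-⟨⟩⁻ : ∀ (t : Term F V) {y σ} → y ∈ᵥ t ⟨ σ ⟩ → ∃ λ x → x ∈ᵥ t × y ∈ᵥ σ x
    ∈ᵥ-⟨⟩⁻ (var x)    y∈           = x , here , y∈
    ∈ᵥ-⟨⟩⁻ (app f ts) (there i y∈) with ∈ᵥ-⟨⟩*⁻ ts i y∈
    ... | x , x∈ , y∈′ = x , there i x∈ , y∈′

    ∈ᵥ-⟨⟩*⁻ : ∀ {n} (ts : Vec (Term F V) n) {y σ} i → y ∈ᵥ lookup (ts ⟨ σ ⟩*) i →
              ∃ λ x → x ∈ᵥ lookup ts i × y ∈ᵥ σ x
    ∈ᵥ-⟨⟩*⁻ (t ∷ ts) zero    y∈ = ∈ᵥ-⟨⟩⁻ t y∈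
    ∈ᵥ-⟨⟩*⁻ (t ∷ ts) (suc i) y∈ = ∈ᵥ-⟨⟩*⁻ ts i y∈

  mutual
    -- Each occurrence of a variable contributes one before the substitution and at least one after
    -- it, so equality of the sums forces equality at every occurrence.
    size-⟨⟩-≡ : ∀ (t : Term F V) {σ} → size (t ⟨ σ ⟩) ≡ size t →
                ∀ x → x ∈ᵥ t → ∃ λ y → σ x ≡ var y
    size-⟨⟩-≡ (var x) {σ} eq .x here with σ x
    ... | var y = y , refl
    ... | app f ts with () ← eq
    size-⟨⟩-≡ (app f ts) eq x (there i x∈) =
      size*-⟨⟩-≡ ts (suc-injective (suc-injective eq)) i x x∈

    size*-⟨⟩-≡ : ∀ {n} (ts : Vec (Term F V) n) {σ} → size* (ts ⟨ σ ⟩*) ≡ size* ts →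
                 ∀ i x → x ∈ᵥ lookup ts i → ∃ λ y → σ x ≡ var y
    size*-⟨⟩-≡ (t ∷ ts) eq zero    = size-⟨⟩-≡ t (proj₁ (+-≡-split (size-⟨⟩ t) (size*-⟨⟩ ts) eq))
    size*-⟨⟩-≡ (t ∷ ts) eq (suc i) =
      size*-⟨⟩-≡ ts (proj₂ (+-≡-split (size-⟨⟩ t) (size*-⟨⟩ ts) eq)) i

  size-root : ∀ C {t : Term F V} → size (C [ t ]) ≡ size t → C ≡ □
  size-root □                   eq = refl
  size-root (inside f ts i C) {t} eq = ⊥-elim (<-irrefl (sym eq) (size-fill-< {inside f ts i C} {t} λ ()))

-- A numerical measure for encompassment.

module Encompassment {F : Signature} {V : Set} (em : ExcludedMiddle 0ℓ) where

  _≟_ : (x y : V) → Dec (x ≡ y)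
  x ≟ y = em

  multiplicity : V → List V → ℕ
  multiplicity x xs = length (filter (x ≟_) xs)

  -- Among terms of equal size, encompassment amounts to variable renaming, and a
  -- renaming that identifies two variables increases this number.
  coincidences : List V → ℕ
  coincidences []       = 0
  coincidences (x ∷ xs) = multiplicity x xs + coincidences xs

  multiplicity-map : ∀ f x xs → multiplicity x xs ≤ multiplicity (f x) (map f xs)
  multiplicity-map f x [] = z≤n
  multiplicity-map f x (y ∷ xs) with x ≟ y
  -- The test `f x ≟ f x` comes from `em` and does not compute; `filter-accept` settles it.
  ... | yes refl rewrite filter-accept (f x ≟_) {x = f x} {xs = map f xs} refl = s≤s (multiplicity-map f x xs)
  ... | no _ with f x ≟ f y
  ...   | yes _ = m≤n⇒m≤1+n (multiplicity-map f x xs)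
  ...   | no _  = multiplicity-map f x xs

  -- Each occurrence of `x` survives as one of `f x`; a different `y` with the same image would
  -- contribute one more.
  multiplicity-map-≡ : ∀ f x xs → multiplicity (f x) (map f xs) ≡ multiplicity x xs →
                       ∀ {y} → y ∈ xs → f x ≡ f y → x ≡ y
  multiplicity-map-≡ f x (z ∷ xs) eq y∈ fx≡fy with x ≟ z
  multiplicity-map-≡ f x (z ∷ xs) eq (here refl) fx≡fy | yes x≡z = x≡z
  multiplicity-map-≡ f x (.x ∷ xs) eq (there y∈) fx≡fy | yes refl
    rewrite filter-accept (f x ≟_) {x = f x} {xs = map f xs} refl =
    multiplicity-map-≡ f x xs (suc-injective eq) y∈ fx≡fy
  ... | no x≢z with f x ≟ f z
  ...   | yes _ = ⊥-elim (<-irrefl (sym eq) (s≤s (multiplicity-map f x xs)))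
  multiplicity-map-≡ f x (z ∷ xs) eq (here refl) fx≡fy | no x≢z | no fx≢fz = ⊥-elim (fx≢fz fx≡fy)
  multiplicity-map-≡ f x (z ∷ xs) eq (there y∈) fx≡fy | no x≢z | no fx≢fz =
    multiplicity-map-≡ f x xs eq y∈ fx≡fy

  coincidences-map : ∀ f xs → coincidences xs ≤ coincidences (map f xs)
  coincidences-map f []       = z≤n
  coincidences-map f (x ∷ xs) = +-mono-≤ (multiplicity-map f x xs) (coincidences-map f xs)

  coincidences-map-≡ : ∀ f xs → coincidences (map f xs) ≡ coincidences xs →
                       ∀ {x y} → x ∈ xs → y ∈ xs → f x ≡ f y → x ≡ y
  coincidences-map-≡ f (z ∷ xs) eq x∈ y∈ fx≡fy
    with +-≡-split (multiplicity-map f z xs) (coincidences-map f xs) eq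
  coincidences-map-≡ f (z ∷ xs) eq (here refl) (here refl) fx≡fy | _ = refl
  coincidences-map-≡ f (z ∷ xs) eq (here refl) (there y∈) fx≡fy | p , _ =
    multiplicity-map-≡ f z xs p y∈ fx≡fy
  coincidences-map-≡ f (z ∷ xs) eq (there x∈) (here refl) fx≡fy | p , _ =
    sym (multiplicity-map-≡ f z xs p x∈ (sym fx≡fy))
  coincidences-map-≡ f (z ∷ xs) eq (there x∈) (there y∈) fx≡fy | _ , q =
    coincidences-map-≡ f xs q x∈ y∈ fx≡fy

  leftInverse : ∀ (f : V → V) xs → (∀ {x y} → x ∈ xs → y ∈ xs → f x ≡ f y → x ≡ y) →
                ∃ λ (g : V → V) → ∀ x → x ∈ xs → g (f x) ≡ x
  leftInverse f xs inj = g , g∘f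
    where
    g : V → V
    g y with em {∃ λ x → x ∈ xs × f x ≡ y}
    ... | yes (x , _) = x
    -- Outside the image of `xs` any value will do.
    ... | no _        = y

    g∘f : ∀ x → x ∈ xs → g (f x) ≡ x
    g∘f x x∈ with em {∃ λ x′ → x′ ∈ xs × f x′ ≡ f x}
    ... | yes (x′ , x′∈ , eq) = inj x′∈ x∈ eq
    ... | no ¬∃               = ⊥-elim (¬∃ (x , x∈ , refl))

  asRenaming : ∀ (l : Term F V) (ρ : Subst) → size (l ⟨ ρ ⟩) ≡ size l →
               ∃ λ (f : V → V) → l ⟨ ρ ⟩ ≡ l ⟨ var ∘ f ⟩
  asRenaming l ρ eq = f , ⟨⟩-cong l f-spec
    where
    f : V → V
    f x with ρ x
    ... | var y   = y
    -- A placeholder: since the sizes agree, no variable of `l` leads here.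
    ... | app _ _ = x

    f-spec : ∀ x → x ∈ᵥ l → ρ x ≡ var (f x)
    f-spec x x∈ with ρ x | size-⟨⟩-≡ l eq x x∈
    ... | var y | _ = refl
    ... | app _ _ | _ , ()

  -- At equal size the context is empty and the substitution acts on `l` as a map of variables,
  -- which cannot lower `coincidences`. If these agree too, the map is injective on the variables of
  -- `l`, and its left inverse yields the converse encompassment. So proper encompassment strictly
  -- decreases the pair lexicographically.
  encompasses-measure : ∀ {s l : Term F V} → Encompasses s l →
    size l < size s ⊎
    (size l ≡ size s × coincidences (vars l) ≤ coincidences (vars s) ×
     (coincidences (vars l) ≡ coincidences (vars s) → Encompasses l s))
  encompasses-measure {s} {l} (C , ρ , refl)
    with m≤n⇒m<n∨m≡n (≤-trans (size-⟨⟩ l) (size-fill C))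
  ... | inj₁ l<s = inj₁ l<s
  ... | inj₂ l≡s
    with size-root C (≤-antisym (≤-trans (≤-reflexive (sym l≡s)) (size-⟨⟩ l)) (size-fill C))
  ... | refl with asRenaming l ρ (sym l≡s)
  ... | f , eq = inj₂ (l≡s , subst (λ u → coincidences (vars l) ≤ coincidences (vars u)) (sym eq)
                                (subst (λ xs → _ ≤ coincidences xs) (sym (vars-rename l f))
                                  (coincidences-map f (vars l)))
                          , variant)
    where
    variant : coincidences (vars l) ≡ coincidences (vars (l ⟨ ρ ⟩)) → Encompasses l (l ⟨ ρ ⟩)
    variant ceq with leftInverse f (vars l) (coincidences-map-≡ f (vars l)
      (trans (cong coincidences (sym (trans (cong vars eq) (vars-rename l f)))) (sym ceq)))
    ... | g , gf = □ , var ∘ g , sym (trans (cong _⟨ var ∘ g ⟩ eq) (trans (⟨⟩-⊙ l)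
      (trans (⟨⟩-cong l (λ x x∈ → cong var (gf x (∈-vars x∈)))) (⟨var⟩ l))))

-- First-order unification.

app-injective-args : ∀ {F : Signature} {V : Set} {f} {ts us : Vec (Term F V) (arity F f)} →
                     app f ts ≡ app f us → ts ≡ us
app-injective-args refl = refl

symbol-≡ : ∀ {F : Signature} {V : Set} {f g} {ts : Vec (Term F V) (arity F f)} {us} →
           app f ts ≡ app g us → f ≡ g
symbol-≡ refl = refl

module Unification {F : Signature} {V : Set} (em : ExcludedMiddle 0ℓ) where

  Equations : Set
  Equations = List (Term F V × Term F V)

  Unifier : Subst {F} {V} → Equations → Set
  Unifier σ = All λ (s , t) → s ⟨ σ ⟩ ≡ t ⟨ σ ⟩

  MostGeneralUnifier : Equations → Set
  MostGeneralUnifier Γ = Σ (Subst {F} {V}) λ μ → Unifier μ Γ ×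
    (∀ σ → Unifier σ Γ → Σ Subst λ τ → ∀ x → σ x ≡ μ x ⟨ τ ⟩)

  same-unifiers : ∀ {Γ Δ} → (∀ {σ} → Unifier σ Γ → Unifier σ Δ) → (∀ {σ} → Unifier σ Δ → Unifier σ Γ) →
                  MostGeneralUnifier Γ → MostGeneralUnifier Δ
  same-unifiers to from (μ , unifies , general) = μ , to unifies , λ σ u → general σ (from u)

  -- Counting left sides is enough, since a unifier gives both sides the same instance.
  weight : Subst {F} {V} → Equations → ℕ
  weight σ []            = 0
  weight σ ((s , t) ∷ Γ) = size (s ⟨ σ ⟩) + weight σ Γ

  pairs : ∀ {n} → Vec (Term F V) n → Vec (Term F V) n → Equations
  pairs []       []       = []
  pairs (t ∷ ts) (u ∷ us) = (t , u) ∷ pairs ts us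

  pairs⁺ : ∀ {n σ} {ts us : Vec (Term F V) n} → ts ⟨ σ ⟩* ≡ us ⟨ σ ⟩* → Unifier σ (pairs ts us)
  pairs⁺ {ts = []}     {[]}     eq = []
  pairs⁺ {ts = t ∷ ts} {u ∷ us} eq = cong head eq ∷ pairs⁺ (cong tail eq)

  pairs⁻ : ∀ {n σ} {ts us : Vec (Term F V) n} → Unifier σ (pairs ts us) → ts ⟨ σ ⟩* ≡ us ⟨ σ ⟩*
  pairs⁻ {ts = []}     {[]}     []        = refl
  pairs⁻ {ts = t ∷ ts} {u ∷ us} (eq ∷ eqs) = cong₂ _∷_ eq (pairs⁻ eqs)

  weight-pairs : ∀ {n} σ (ts us : Vec (Term F V) n) Γ →
                 weight σ (pairs ts us ++ Γ) ≡ size* (ts ⟨ σ ⟩*) + weight σ Γ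
  weight-pairs σ []       []       Γ = refl
  weight-pairs σ (t ∷ ts) (u ∷ us) Γ =
    trans (cong (size (t ⟨ σ ⟩) +_) (weight-pairs σ ts us Γ)) (sym (+-assoc (size (t ⟨ σ ⟩)) _ _))

  infix 40 _↦_
  _↦_ : V → Term F V → Subst {F} {V}
  (x ↦ t) y with em {x ≡ y}
  ... | yes _ = t
  ... | no _  = var y

  ↦-same : ∀ x t → (x ↦ t) x ≡ t
  ↦-same x t with em {x ≡ x}
  ... | yes _  = refl
  ... | no x≢x = ⊥-elim (x≢x refl)

  ↦-other : ∀ {x y} t → x ≢ y → (x ↦ t) y ≡ var y
  ↦-other {x} {y} t x≢y with em {x ≡ y}
  ... | yes x≡y = ⊥-elim (x≢y x≡y)
  ... | no _    = refl

  ↦-absorb : ∀ {σ x t} → σ x ≡ t ⟨ σ ⟩ → ∀ y → ((x ↦ t) ⊙ σ) y ≡ σ y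
  ↦-absorb {x = x} σx y with em {x ≡ y}
  ... | yes refl = sym σx
  ... | no _     = refl

  instantiate : Subst {F} {V} → Equations → Equations
  instantiate δ = map λ (s , t) → s ⟨ δ ⟩ , t ⟨ δ ⟩

  absorbed : ∀ δ {σ : Subst {F} {V}} → (∀ y → (δ ⊙ σ) y ≡ σ y) → ∀ t → t ⟨ δ ⟩ ⟨ σ ⟩ ≡ t ⟨ σ ⟩
  absorbed δ abs t = trans (⟨⟩-⊙ t) (⟨⟩-cong t λ y _ → abs y)

  instantiate⁺ : ∀ δ {σ} → (∀ y → (δ ⊙ σ) y ≡ σ y) → ∀ {Γ} → Unifier σ Γ → Unifier σ (instantiate δ Γ)
  instantiate⁺ δ abs []                     = []
  instantiate⁺ δ abs {(s , t) ∷ _} (eq ∷ u) =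
    trans (absorbed δ abs s) (trans eq (sym (absorbed δ abs t))) ∷ instantiate⁺ δ abs u

  instantiate⁻ : ∀ {δ σ} Γ → Unifier σ (instantiate δ Γ) → Unifier (δ ⊙ σ) Γ
  instantiate⁻ []            []       = []
  instantiate⁻ ((s , t) ∷ Γ) (eq ∷ u) = trans (sym (⟨⟩-⊙ s)) (trans eq (⟨⟩-⊙ t)) ∷ instantiate⁻ Γ u

  weight-instantiate : ∀ δ {σ} → (∀ y → (δ ⊙ σ) y ≡ σ y) → ∀ Γ → weight σ (instantiate δ Γ) ≡ weight σ Γ
  weight-instantiate δ abs []            = refl
  weight-instantiate δ abs ((s , t) ∷ Γ) = cong₂ _+_ (cong size (absorbed δ abs s)) (weight-instantiate δ abs Γ)

  -- A unifier of `var x` and `t` absorbs the binding, so it also unifies the instantiated rest and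
  -- factors through `μ`; precomposing with the binding does not change it.
  eliminate : ∀ {x t Γ} → ¬ x ∈ᵥ t → MostGeneralUnifier (instantiate (x ↦ t) Γ) →
              MostGeneralUnifier ((var x , t) ∷ Γ)
  eliminate {x} {t} {Γ} x∉t (μ , unifies , general) = (x ↦ t) ⊙ μ , solves ∷ instantiate⁻ Γ unifies , general′
    where
    solves : (x ↦ t) x ⟨ μ ⟩ ≡ t ⟨ (x ↦ t) ⊙ μ ⟩
    solves = trans (cong _⟨ μ ⟩ (↦-same x t)) (⟨⟩-cong t λ y y∈ → cong _⟨ μ ⟩ (sym (↦-other t λ { refl → x∉t y∈ })))

    general′ : ∀ σ → Unifier σ ((var x , t) ∷ Γ) → Σ Subst λ τ → ∀ y → σ y ≡ ((x ↦ t) ⊙ μ) y ⟨ τ ⟩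
    general′ σ (eq ∷ u) with general σ (instantiate⁺ (x ↦ _) (↦-absorb eq) u)
    ... | τ , fac = τ , λ y → trans (sym (↦-absorb eq y)) (trans (⟨⟩-cong ((x ↦ t) y) λ z _ → fac z) (sym (⟨⟩-⊙ ((x ↦ t) y))))

  -- If `x` occurred strictly inside `t`, then `σ x` would be smaller than `t ⟨ σ ⟩`, that is, than
  -- itself.
  occurs-check : ∀ {σ : Subst {F} {V}} {x t} → σ x ≡ t ⟨ σ ⟩ → t ≢ var x → ¬ x ∈ᵥ t
  occurs-check {t = var y}    eq t≢ here = t≢ refl
  occurs-check {σ} {t = app f ts} eq t≢ x∈ = <-irrefl (cong size eq) (∈ᵥ-app-size σ x∈)

  -- A unifier σ of Γ bounds the run of the algorithm: eliminating a variable
  -- does not change the σ-instances of the remaining equations.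
  unify : ∀ n Γ σ → Unifier σ Γ → weight σ Γ ≤ n → MostGeneralUnifier Γ
  unify-var : ∀ n x t Γ σ → Unifier σ ((var x , t) ∷ Γ) → weight σ Γ ≤ n → MostGeneralUnifier ((var x , t) ∷ Γ)

  unify n [] σ u w = var , [] , λ σ _ → σ , λ x → refl
  unify zero ((s , t) ∷ Γ) σ u w = ⊥-elim (<⇒≱ (0<size (s ⟨ σ ⟩)) (≤-trans (m≤m+n _ _) w))
  unify (suc n) ((var x , t) ∷ Γ) σ u w =
    unify-var n x t Γ σ u (s≤s⁻¹ (≤-trans (+-monoˡ-≤ _ (0<size (σ x))) w))
  unify (suc n) ((app f ts , var x) ∷ Γ) σ (eq ∷ u) w =
    same-unifiers (λ { (eq ∷ u) → sym eq ∷ u }) (λ { (eq ∷ u) → sym eq ∷ u })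
      (unify-var n x (app f ts) Γ σ (sym eq ∷ u) (s≤s⁻¹ (≤-trans (s≤s (m≤n+m _ (suc (size* (ts ⟨ σ ⟩*))))) w)))
  unify (suc n) ((app f ts , app g us) ∷ Γ) σ (eq ∷ u) w with symbol-≡ eq
  ... | refl =
    same-unifiers (λ u → cong (app f) (pairs⁻ (++⁻ˡ (pairs ts us) u)) ∷ ++⁻ʳ (pairs ts us) u)
                  (λ { (eq ∷ u) → ++⁺ (pairs⁺ {ts = ts} (app-injective-args eq)) u })
      (unify n (pairs ts us ++ Γ) σ (++⁺ (pairs⁺ {ts = ts} (app-injective-args eq)) u)
        (≤-trans (≤-reflexive (weight-pairs σ ts us Γ)) (≤-trans (m≤n+m _ 1) (s≤s⁻¹ w))))

  unify-var n x t Γ σ (eq ∷ u) w with em {t ≡ var x}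
  ... | yes refl = same-unifiers (refl ∷_) (λ { (_ ∷ u) → u }) (unify n Γ σ u w)
  ... | no t≢x   = eliminate (occurs-check eq t≢x)
    (unify n (instantiate (x ↦ t) Γ) σ (instantiate⁺ (x ↦ _) (↦-absorb eq) u)
      (≤-trans (≤-reflexive (weight-instantiate (x ↦ t) (↦-absorb eq) Γ)) w))

  -- The given unifier both rules out failure and, through its weight, bounds the recursion.
  mgu-exists : ∀ {s t : Term F V} (σ : Subst) → s ⟨ σ ⟩ ≡ t ⟨ σ ⟩ → Σ (Subst {F} {V}) λ μ → IsMGU μ s t
  mgu-exists {s} {t} σ eq with unify _ ((s , t) ∷ []) σ (eq ∷ []) ≤-refl
  ... | μ , (u ∷ []) , general = μ , record { unifies = u ; mostGeneral = λ σ eq → general σ (eq ∷ []) }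

-- Renaming variables apart.

module Renaming {V : Set} (em : ExcludedMiddle 0ℓ) (inf : Infinite V) where

  transpose : V → V → V → V
  transpose a b x with em {x ≡ a} | em {x ≡ b}
  ... | yes _ | _     = b
  ... | no _  | yes _ = a
  ... | no _  | no _  = x

  transpose-left : ∀ a b → transpose a b a ≡ b
  transpose-left a b with em {a ≡ a}
  ... | yes _  = refl
  ... | no a≢a = ⊥-elim (a≢a refl)

  transpose-fixed : ∀ {a b x} → x ≢ a → x ≢ b → transpose a b x ≡ x
  transpose-fixed {a} {b} {x} x≢a x≢b with em {x ≡ a} | em {x ≡ b}
  ... | yes x≡a | _       = ⊥-elim (x≢a x≡a)
  ... | no _    | yes x≡b = ⊥-elim (x≢b x≡b)
  ... | no _    | no _    = refl

  transpose-right : ∀ a b → transpose a b b ≡ a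
  transpose-right a b with em {b ≡ a} | em {b ≡ b}
  ... | yes b≡a | _       = b≡a
  ... | no _    | yes _   = refl
  ... | no _    | no b≢b  = ⊥-elim (b≢b refl)

  transpose-involutive : ∀ a b x → transpose a b (transpose a b x) ≡ x
  transpose-involutive a b x with em {x ≡ a} | em {x ≡ b}
  ... | yes refl | _        = transpose-right x b
  ... | no _     | yes refl = transpose-left a x
  ... | no x≢a   | no x≢b   = transpose-fixed x≢a x≢b

  transposition : V → V → V ↔ V
  transposition a b = mk↔ₛ′ (transpose a b) (transpose a b) (transpose-involutive a b) (transpose-involutive a b)

  -- If the renaming built for `A` sends `a` into `B`, that image is swapped with a fresh `z`. The
  -- images of `A` do not move: they avoid `B`, hence the image of `a`, and `z` is chosen outside
  -- them. Transpositions keep the renaming bijective, as variants require.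
  renaming-apart : ∀ (A B : List V) → Σ (V ↔ V) λ π → ∀ x → x ∈ A → Inverse.to π x ∉ B
  renaming-apart []      B = ↔-id V , λ x ()
  renaming-apart (a ∷ A) B with renaming-apart A B
  ... | π , apart with em {Inverse.to π a ∈ B}
  ...   | no πa∉   = π , λ { x (here refl) → πa∉ ; x (there x∈) → apart x x∈ }
  ...   | yes πa∈ with inf (B ++ map (Inverse.to π) A)
  ...     | z , z∉ = transposition (Inverse.to π a) z ↔-∘ π , apart′
    where
    apart′ : ∀ x → x ∈ a ∷ A → transpose (Inverse.to π a) z (Inverse.to π x) ∉ B
    apart′ x (here refl) = subst (_∉ B) (sym (transpose-left _ z)) (z∉ ∘ ∈-++⁺ˡ)
    apart′ x (there x∈)  = subst (_∉ B) (sym (transpose-fixed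
      (λ eq → apart x x∈ (subst (_∈ B) (sym eq) πa∈))
      (λ eq → z∉ (∈-++⁺ʳ B (subst (_∈ _) eq (∈-map⁺ (Inverse.to π) x∈)))))) (apart x x∈)

-- Rewrite steps and conversions with bounded terms.

module _ {F : Signature} {V : Set} where

  step-[] : ∀ {X : Rel (Term F V) 0ℓ} C {s t} → Step X s t → Step X (C [ s ]) (C [ t ])
  step-[] C (step x D σ refl refl) = step x (C ∘ᶜ D) σ (sym (∘ᶜ-[] C D)) (sym (∘ᶜ-[] C D))

  step-⟨⟩ : ∀ {X : Rel (Term F V) 0ℓ} σ {s t} → Step X s t → Step X (s ⟨ σ ⟩) (t ⟨ σ ⟩)
  step-⟨⟩ σ (step {l} {r} x D ρ refl refl) =
    step x (D ⟨ σ ⟩ᶜ) (ρ ⊙ σ) (fill-instance □ D l) (fill-instance □ D r)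

  step-base : ∀ {X : Rel (Term F V) 0ℓ} {s t} → X s t → Step X s t
  step-base {s = s} {t} x = step x □ var (sym (⟨var⟩ s)) (sym (⟨var⟩ t))

  step-map : ∀ {X Y : Rel (Term F V) 0ℓ} → X ⇒ Y → Step X ⇒ Step Y
  step-map f (step x C σ eq₁ eq₂) = step (f x) C σ eq₁ eq₂

  conversion-extend : ∀ {X Y : Rel (Term F V) 0ℓ} → X ⇒ Conversion Y → Conversion X ⇒ Conversion Y
  conversion-extend f = Eq._⋆ λ where
    (step x C σ refl refl) → Eq.gmap (λ t → C [ t ⟨ σ ⟩ ]) (step-[] C ∘ step-⟨⟩ σ) (f x)

  -- Both ends are bounded, which makes the notion symmetric; an empty chain then carries no
  -- condition.
  BoundedStep : Rel (Term F V) 0ℓ → (Term F V → Set) → Rel (Term F V) 0ℓ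
  BoundedStep X P s t = P s × P t × SymClosure (Step X) s t

  Bounded : Rel (Term F V) 0ℓ → (Term F V → Set) → Rel (Term F V) 0ℓ
  Bounded X P = Star (BoundedStep X P)

  module _ {X : Rel (Term F V) 0ℓ} where

    bounded-weaken : ∀ {P Q : Term F V → Set} → (∀ {w} → P w → Q w) → Bounded X P ⇒ Bounded X Q
    bounded-weaken f = Star.map λ (p , q , st) → f p , f q , st

    bounded-sym : ∀ {P : Term F V → Set} {s t} → Bounded X P s t → Bounded X P t s
    bounded-sym = Star.reverse λ (p , q , st) → q , p , Sym.symmetric _ st

    bounded-[] : ∀ {P Q : Term F V → Set} C → (∀ {w} → P w → Q (C [ w ])) →
                 ∀ {s t} → Bounded X P s t → Bounded X Q (C [ s ]) (C [ t ])
    bounded-[] C f = Star.gmap (C [_]) λ (p , q , st) → f p , f q , Sym.gmap (C [_]) (step-[] C) st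

    bounded-⟨⟩ : ∀ {P Q : Term F V → Set} σ → (∀ {w} → P w → Q (w ⟨ σ ⟩)) →
                 ∀ {s t} → Bounded X P s t → Bounded X Q (s ⟨ σ ⟩) (t ⟨ σ ⟩)
    bounded-⟨⟩ σ f = Star.gmap (_⟨ σ ⟩) λ (p , q , st) → f p , f q , Sym.gmap (_⟨ σ ⟩) (step-⟨⟩ σ) st

    bounded-conversion : ∀ {P : Term F V → Set} → Bounded X P ⇒ Conversion X
    bounded-conversion = Star.map λ (_ , _ , st) → st

-- Reduction orders.

module OrderProperties {F : Signature} {V : Set} {_>_ : Rel (Term F V) 0ℓ} (ord : IsReductionOrder _>_) where
  open IsReductionOrder ord public
  open IsStrictPartialOrder isStrictPartialOrder public
    using () renaming (trans to >-trans; irrefl to >-irrefl; asym to >-asym)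

  infix 4 _≥_
  _≥_ : Rel (Term F V) 0ℓ
  s ≥ t = s ≡ t ⊎ s > t

  >-≥-trans : ∀ {s t u} → s > t → t ≥ u → s > u
  >-≥-trans s>t (inj₁ refl) = s>t
  >-≥-trans s>t (inj₂ t>u)  = >-trans s>t t>u

  step-> : ∀ {X} → X ⇒ _>_ → Step X ⇒ _>_
  step-> X⊆> (step x C σ refl refl) = context-closed C (subst-closed σ (X⊆> x))

  ordered-> : ∀ {E} → Ordered _>_ E ⇒ _>_
  ordered-> (ordered _ _ _ _ s>t) = s>t

-- Items of a run, their ranks and what becomes of them.

module Persistence {F : Signature} {V : Set} (em : ExcludedMiddle 0ℓ)
  {_>_ : Rel (Term F V) 0ℓ} (ord : IsReductionOrder _>_)
  (E R : ℕ → Rel (Term F V) 0ℓ) (run : IsRun _>_ E R) (R₀-empty : Empty (R 0)) where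

  open OrderProperties ord
  open Encompassment {F} {V} em

  Rank : Set
  Rank = ℕ × ℕ

  _⊏_ : Rel Rank 0ℓ
  _⊏_ = ×-Lex _≡_ _<_ _<_

  ⊏-wellFounded : WellFounded _⊏_
  ⊏-wellFounded = ×-wellFounded <-wellFounded <-wellFounded

  -- Kinds are numbers so that `rank` can add them. Equations enter in both directions because a
  -- rank looks only at the left side.
  data Item (i : ℕ) : ℕ → Term F V → Term F V → Set where
    rule     : ∀ {l r} → R i l r → Item i 0 l r
    equation : ∀ {l r} → (E i ±) l r → Item i 1 l r

  -- Encompassment is compared before the kind of the item (0 for rules, 1 for equations);
  -- doubling the first quantity lets a strict decrease of it outweigh the kind.
  rank : Term F V → ℕ → Rank
  rank l k = size l , (coincidences (vars l) + coincidences (vars l) + k)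

  rule-⊏-equation : ∀ s → rank s 0 ⊏ rank s 1
  rule-⊏-equation s = inj₂ (refl , +-monoʳ-< (coincidences (vars s) + coincidences (vars s)) (s≤s z≤n))

  -- Encompassment need not be proper here: if `l` is a variant of `s`, the kind alone makes the
  -- rank drop. This is why equations may be simplified by rules without restriction.
  encompasses-⊏ : ∀ {s l} → Encompasses s l → rank l 0 ⊏ rank s 1
  encompasses-⊏ s⊵l with encompasses-measure s⊵l
  ... | inj₁ l<s             = inj₁ l<s
  ... | inj₂ (l≡s , c≤c , _) = inj₂ (l≡s , +-mono-≤-< (+-mono-≤ c≤c c≤c) (s≤s z≤n))

  properlyEncompasses-⊏ : ∀ {s l k k′} → ProperlyEncompasses s l → k ≤ 1 → rank l k ⊏ rank s k′
  properlyEncompasses-⊏ {s} {l} {k} {k′} (s⊵l , ¬l⊵s) k≤1 with encompasses-measure s⊵l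
  ... | inj₁ l<s                   = inj₁ l<s
  ... | inj₂ (l≡s , c≤c , variant) = inj₂ (l≡s , doubled (≤∧≢⇒< c≤c (¬l⊵s ∘ variant)))
    where
    doubled : ∀ {c d} → c < d → c + c + k < d + d + k′
    doubled {c} {d} c<d = begin-strict
      c + c + k      ≤⟨ +-monoʳ-≤ (c + c) k≤1 ⟩
      c + c + 1      ≡⟨ +-assoc c c 1 ⟩
      c + (c + 1)    ≡⟨ cong (c +_) (+-comm c 1) ⟩
      c + suc c      <⟨ +-mono-<-≤ c<d c<d ⟩
      d + d          ≤⟨ m≤m+n (d + d) k′ ⟩
      d + d + k′     ∎
      where open ≤-Reasoning

  -- `K` keeps what the inference rule guarantees about the item used: a rank below that of the
  -- rewritten side, or nothing. It refers to the uninstantiated `l`, so it survives closure under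
  -- contexts and substitutions.
  record Reduction (i : ℕ) (K : Term F V → ℕ → Set) (s u : Term F V) : Set where
    constructor reduction
    field
      {kind}     : ℕ
      {l r}      : Term F V
      item       : Item i kind l r
      C          : Context
      ρ          : Subst
      s≡         : s ≡ C [ l ⟨ ρ ⟩ ]
      u≡         : u ≡ C [ r ⟨ ρ ⟩ ]
      decreasing : l ⟨ ρ ⟩ > r ⟨ ρ ⟩
      allowed    : K l kind

  reduction-> : ∀ {i K s u} → Reduction i K s u → s > u
  reduction-> (reduction _ C _ refl refl l>r _) = context-closed C l>r

  reduction-instance : ∀ {i K s u} C σ → Reduction i K s u → Reduction i K (C [ s ⟨ σ ⟩ ]) (C [ u ⟨ σ ⟩ ])
  reduction-instance C σ (reduction {l = l} {r} item D ρ refl refl l>r allowed) =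
    reduction item (C ∘ᶜ D ⟨ σ ⟩ᶜ) (ρ ⊙ σ) (fill-instance C D l) (fill-instance C D r)
      (subst₂ _>_ (⟨⟩-⊙ l) (⟨⟩-⊙ r) (subst-closed σ l>r)) allowed

  AnyItem : Term F V → ℕ → Set
  AnyItem _ _ = ⊤

  -- What replaces a lost item. After `reducedˡ` an equation remains, as in simplify and collapse;
  -- in `reducedʳ` the left side and the kind, hence the rank, are preserved.
  data Fate (i : ℕ) : ℕ → Term F V → Term F V → Set where
    oriented→ : ∀ {s t} → R (suc i) s t → s > t → Fate i 1 s t
    oriented← : ∀ {s t} → R (suc i) t s → t > s → Fate i 1 s t
    deleted   : ∀ {s} → Fate i 1 s s
    reducedˡ  : ∀ {k s t u} → Reduction i (λ l k′ → rank l k′ ⊏ rank s k) s u →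
                (E (suc i) ±) u t → Fate i k s t
    reducedʳ  : ∀ {k s t u} → Reduction i AnyItem t u → Item (suc i) k s u → Fate i k s t

  -- Starting from no rules, orient adds only decreasing pairs and compose only lowers right-hand
  -- sides.
  rules-> : ∀ i → R i ⇒ _>_
  rules-> zero    r = ⊥-elim (R₀-empty r)
  rules-> (suc i) r with run i
  ... | _ , _ , (_ , (_ , R←)) , st , (_ , (_ , R′←)) = from-step st (rules-> i ∘ R←) (R′← r)
    where
    from-step : ∀ {Ẽ R̃ Ẽ′ R̃′} → _⊢_ _>_ (Ẽ , R̃) (Ẽ′ , R̃′) → R̃ ⇒ _>_ → R̃′ ⇒ _>_
    from-step (deduce _ _)      old r                    = old r
    from-step (orientˡ _ s>t)   old (inj₁ r)             = old r
    from-step (orientˡ _ s>t)   old (inj₂ (refl , refl)) = s>t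
    from-step (orientʳ _ t>s)   old (inj₁ r)             = old r
    from-step (orientʳ _ t>s)   old (inj₂ (refl , refl)) = t>s
    from-step (delete _)        old r                    = old r
    from-step (compose _ t→u)   old (inj₁ r)             = old (inj₁ r)
    from-step (compose _ t→u)   old (inj₂ (refl , refl)) =
      >-trans (old (inj₂ (refl , refl))) (step-> [ ordered-> , old ∘ inj₁ ]′ t→u)
    from-step (simplifyˡ _ _)   old r                    = old r
    from-step (simplifyʳ _ _)   old r                    = old r
    from-step (collapse _ _)    old r                    = old (inj₁ r)

  rule-reduction : ∀ {i s u} → Step (R i) s u → Reduction i (λ l k → rank l k ⊏ rank s 1) s u
  rule-reduction (step r C ρ refl refl) =
    reduction (rule r) C ρ refl refl (subst-closed ρ (rules-> _ r)) (encompasses-⊏ (C , ρ , refl))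

  rule-reduction▷ : ∀ {i s u k} → Step▷ (R i) s u → Reduction i (λ l k′ → rank l k′ ⊏ rank s k) s u
  rule-reduction▷ (step (r , s▷l) C ρ refl refl) =
    reduction (rule r) C ρ refl refl (subst-closed ρ (rules-> _ r)) (properlyEncompasses-⊏ s▷l z≤n)

  equation-reduction▷ : ∀ {i s u k} → OrderedStep▷ _>_ (E i) s u → Reduction i (λ l k′ → rank l k′ ⊏ rank s k) s u
  equation-reduction▷ (step e C ρ refl refl l>r s▷l) =
    reduction (equation e) C ρ refl refl l>r (properlyEncompasses-⊏ s▷l (s≤s z≤n))

  ordered-reduction : ∀ {i s u} → Step (Ordered _>_ (E i) ∪ R i) s u → Reduction i AnyItem s u
  ordered-reduction (step (inj₁ (ordered {l} {r} e σ refl refl l>r)) C ρ refl refl) =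
    reduction (equation e) C (σ ⊙ ρ) (cong (C [_]) (⟨⟩-⊙ l)) (cong (C [_]) (⟨⟩-⊙ r))
      (subst₂ _>_ (⟨⟩-⊙ l) (⟨⟩-⊙ r) (subst-closed ρ l>r)) tt
  ordered-reduction (step (inj₂ r) C ρ refl refl) =
    reduction (rule r) C ρ refl refl (subst-closed ρ (rules-> _ r)) tt

  forget-rank : ∀ {i K s u} → Reduction i K s u → Reduction i AnyItem s u
  forget-rank (reduction item C ρ s≡ u≡ l>r _) = reduction item C ρ s≡ u≡ l>r tt

  orderedStep▷-map : ∀ {E E′ : Rel (Term F V) 0ℓ} → E ⇒ E′ → OrderedStep▷ _>_ E ⇒ OrderedStep▷ _>_ E′
  orderedStep▷-map f (step e C σ eq₁ eq₂ l>r s▷l) = step (Sym.map f e) C σ eq₁ eq₂ l>r s▷l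

  ordered-map : ∀ {E E′ : Rel (Term F V) 0ℓ} → E ⇒ E′ → Ordered _>_ E ⇒ Ordered _>_ E′
  ordered-map f (ordered e σ eq₁ eq₂ s>t) = ordered (Sym.map f e) σ eq₁ eq₂ s>t

  module _ {i : ℕ} where

    -- The inclusions bridge the extensional equality between the states of the inference and those
    -- of the run. Both directions are treated at once, since the loss of an equation affects both
    -- of its items.
    equation-fate : ∀ {Ẽ R̃ Ẽ′ R̃′} → _⊢_ _>_ (Ẽ , R̃) (Ẽ′ , R̃′) →
      Ẽ ⇒ E i → R̃ ⇒ R i → Ẽ′ ⇒ E (suc i) → R̃′ ⇒ R (suc i) →
      ∀ {s t} → Ẽ s t → E (suc i) s t ⊎ (Fate i 1 s t × Fate i 1 t s)
    equation-fate (deduce _ _) E→ R→ E′→ R′→ e = inj₁ (E′→ (inj₁ e))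
    equation-fate (orientˡ _ s>t) E→ R→ E′→ R′→ (inj₁ e) = inj₁ (E′→ e)
    equation-fate (orientˡ _ s>t) E→ R→ E′→ R′→ (inj₂ (refl , refl)) =
      inj₂ (oriented→ (R′→ (inj₂ (refl , refl))) s>t , oriented← (R′→ (inj₂ (refl , refl))) s>t)
    equation-fate (orientʳ _ s>t) E→ R→ E′→ R′→ (inj₁ e) = inj₁ (E′→ e)
    equation-fate (orientʳ _ s>t) E→ R→ E′→ R′→ (inj₂ (refl , refl)) =
      inj₂ (oriented← (R′→ (inj₂ (refl , refl))) s>t , oriented→ (R′→ (inj₂ (refl , refl))) s>t)
    equation-fate (delete _) E→ R→ E′→ R′→ (inj₁ e) = inj₁ (E′→ e)
    equation-fate (delete _) E→ R→ E′→ R′→ (inj₂ (refl , refl)) = inj₂ (deleted , deleted)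
    equation-fate (compose _ _) E→ R→ E′→ R′→ e = inj₁ (E′→ e)
    equation-fate (simplifyˡ _ _) E→ R→ E′→ R′→ (inj₁ e) = inj₁ (E′→ (inj₁ e))
    equation-fate (simplifyˡ _ s→u) E→ R→ E′→ R′→ (inj₂ (refl , refl)) = inj₂
      ( reducedˡ red (fwd (E′→ (inj₂ (refl , refl))))
      , reducedʳ (forget-rank red) (equation (bwd (E′→ (inj₂ (refl , refl))))))
      where red = [ rule-reduction ∘ step-map R→ , equation-reduction▷ ∘ orderedStep▷-map (E→ ∘ inj₁) ]′ s→u
    equation-fate (simplifyʳ _ _) E→ R→ E′→ R′→ (inj₁ e) = inj₁ (E′→ (inj₁ e))
    equation-fate (simplifyʳ _ s→u) E→ R→ E′→ R′→ (inj₂ (refl , refl)) = inj₂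
      ( reducedʳ (forget-rank red) (equation (fwd (E′→ (inj₂ (refl , refl)))))
      , reducedˡ red (bwd (E′→ (inj₂ (refl , refl)))))
      where red = [ rule-reduction ∘ step-map R→ , equation-reduction▷ ∘ orderedStep▷-map (E→ ∘ inj₁) ]′ s→u
    equation-fate (collapse _ _) E→ R→ E′→ R′→ e = inj₁ (E′→ (inj₁ e))

    rule-fate : ∀ {Ẽ R̃ Ẽ′ R̃′} → _⊢_ _>_ (Ẽ , R̃) (Ẽ′ , R̃′) →
      Ẽ ⇒ E i → R̃ ⇒ R i → Ẽ′ ⇒ E (suc i) → R̃′ ⇒ R (suc i) →
      ∀ {s t} → R̃ s t → R (suc i) s t ⊎ Fate i 0 s t
    rule-fate (deduce _ _) E→ R→ E′→ R′→ r = inj₁ (R′→ r)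
    rule-fate (orientˡ _ _) E→ R→ E′→ R′→ r = inj₁ (R′→ (inj₁ r))
    rule-fate (orientʳ _ _) E→ R→ E′→ R′→ r = inj₁ (R′→ (inj₁ r))
    rule-fate (delete _) E→ R→ E′→ R′→ r = inj₁ (R′→ r)
    rule-fate (compose _ _) E→ R→ E′→ R′→ (inj₁ r) = inj₁ (R′→ (inj₁ r))
    rule-fate (compose _ t→u) E→ R→ E′→ R′→ (inj₂ (refl , refl)) = inj₂ (reducedʳ
      (ordered-reduction (step-map [ inj₁ ∘ ordered-map E→ , inj₂ ∘ R→ ∘ inj₁ ]′ t→u))
      (rule (R′→ (inj₂ (refl , refl)))))
    rule-fate (simplifyˡ _ _) E→ R→ E′→ R′→ r = inj₁ (R′→ r)
    rule-fate (simplifyʳ _ _) E→ R→ E′→ R′→ r = inj₁ (R′→ r)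
    rule-fate (collapse _ _) E→ R→ E′→ R′→ (inj₁ r) = inj₁ (R′→ r)
    rule-fate (collapse _ t→u) E→ R→ E′→ R′→ (inj₂ (refl , refl)) = inj₂ (reducedˡ
      ([ rule-reduction▷ ∘ step-map (λ (r , s▷l) → R→ (inj₁ r) , s▷l)
       , equation-reduction▷ ∘ orderedStep▷-map E→ ]′ t→u)
      (fwd (E′→ (inj₂ (refl , refl)))))

  -- Excluded middle asks whether a loss happens at any stage at all; if not, `next` carries `A`
  -- forward forever. The stage found may even precede `i`: the later induction does not look at
  -- stages.
  persists-or-lost : ∀ {A B : ℕ → Set} → (∀ i → A i → A (suc i) ⊎ B i) →
                     ∀ {i} → A i → (∀ j → i ≤ j → A j) ⊎ ∃ B
  persists-or-lost {A} {B} next {i} a with em {∃ B}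
  ... | yes b = inj₂ b
  ... | no ¬b = inj₁ (λ j i≤j → subst A (m∸n+n≡m i≤j) (forever (j ∸ i)))
    where
    forever : ∀ d → A (d + i)
    forever zero    = a
    forever (suc d) with next (d + i) (forever d)
    ... | inj₁ a′ = a′
    ... | inj₂ b  = ⊥-elim (¬b (d + i , b))

  Limit : Rel (Term F V) 0ℓ
  Limit = liminf E ∪ liminf R

  item-fate : ∀ {i k s t} → Item i k s t → (Limit ±) s t ⊎ ∃ λ j → Fate j k s t
  item-fate (rule r) with persists-or-lost next r
    where
    next : ∀ {s t} i → R i s t → R (suc i) s t ⊎ Fate i 0 s t
    next i r with run i
    ... | _ , _ , ((E→ , E←) , (R→ , R←)) , st , ((E′→ , _) , (R′→ , _)) =
      rule-fate st E← R← E′→ R′→ (R→ r)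
  ... | inj₁ persistent = inj₁ (fwd (inj₂ (_ , persistent)))
  ... | inj₂ lost       = inj₂ lost
  item-fate (equation e) = either e
    where
    next : ∀ {s t} i → E i s t → E (suc i) s t ⊎ (Fate i 1 s t × Fate i 1 t s)
    next i e with run i
    ... | _ , _ , ((E→ , E←) , (R→ , R←)) , st , ((E′→ , _) , (R′→ , _)) =
      equation-fate st E← R← E′→ R′→ (E→ e)

    either : ∀ {i s t} → (E i ±) s t → (Limit ±) s t ⊎ ∃ λ j → Fate j 1 s t
    either (fwd e) with persists-or-lost next e
    ... | inj₁ persistent     = inj₁ (fwd (inj₁ (_ , persistent)))
    ... | inj₂ (j , lost , _) = inj₂ (j , lost)
    either (bwd e) with persists-or-lost next e
    ... | inj₁ persistent     = inj₁ (bwd (inj₁ (_ , persistent)))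
    ... | inj₂ (j , _ , lost) = inj₂ (j , lost)

  -- Bounded limit conversions for lost items.

  limit-step : ∀ {s t} C σ → (Limit ±) s t → SymClosure (Step Limit) (C [ s ⟨ σ ⟩ ]) (C [ t ⟨ σ ⟩ ])
  limit-step C σ = Sym.gmap (λ t → C [ t ⟨ σ ⟩ ]) (step-[] C ∘ step-⟨⟩ σ ∘ step-base)

  -- `S` and `T` are separated from context and substitution because the same `S` reappears as an
  -- instance of the item that reduces it.
  Oriented : Term F V → Term F V → ℕ → Term F V → Term F V → Set
  Oriented S T k s t = ∀ {i} → Item i k s t → ∀ C σ → S ≡ C [ s ⟨ σ ⟩ ] → T ≡ C [ t ⟨ σ ⟩ ] → S > T →
                       Bounded Limit (S ≥_) S T

  OrientedAt : Term F V → Set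
  OrientedAt S = ∀ {T k s t} → Oriented S T k s t

  oriented-reduction : ∀ {i K S T} → OrientedAt S → Reduction i K S T → Bounded Limit (S ≥_) S T
  oriented-reduction O red@(reduction item C ρ s≡ u≡ _ _) = O item C ρ s≡ u≡ (reduction-> red)

  -- `S` and `T` may be incomparable, so the bound mentions both. A new orientation hands the pair
  -- to the oriented case. A reduction of one side is itself an oriented pair, and the equation left
  -- over has that side strictly smaller, which drives the recursion on the accessibility proofs.
  unoriented : ∀ {S T} → (∀ {S′} → S ≥ S′ → OrientedAt S′) → (∀ {T′} → T ≥ T′ → OrientedAt T′) →
               Acc (flip _>_) S → Acc (flip _>_) T →
               ∀ {i s t} → (E i ±) s t → ∀ C σ → S ≡ C [ s ⟨ σ ⟩ ] → T ≡ C [ t ⟨ σ ⟩ ] →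
               Bounded Limit (λ w → S ≥ w ⊎ T ≥ w) S T
  unoriented OS OT (acc rs) (acc rt) e C σ refl refl with item-fate (equation e)
  ... | inj₁ persistent = (inj₁ (inj₁ refl) , inj₂ (inj₁ refl) , limit-step C σ persistent) ◅ ε
  ... | inj₂ (_ , oriented→ r s>t) = bounded-weaken inj₁
    (OS (inj₁ refl) (rule r) C σ refl refl (context-closed C (subst-closed σ s>t)))
  ... | inj₂ (_ , oriented← r t>s) = bounded-weaken inj₂ (bounded-sym
    (OT (inj₁ refl) (rule r) C σ refl refl (context-closed C (subst-closed σ t>s))))
  ... | inj₂ (_ , deleted) = ε
  ... | inj₂ (_ , reducedˡ red e′) =
    bounded-weaken inj₁ (oriented-reduction (OS (inj₁ refl)) red′) ◅◅
    bounded-weaken [ inj₁ ∘ inj₂ ∘ >-≥-trans S>U , inj₂ ]′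
      (unoriented (OS ∘ inj₂ ∘ >-≥-trans S>U) OT (rs S>U) (acc rt) e′ C σ refl refl)
    where
    red′ = reduction-instance C σ red
    S>U  = reduction-> red′
  ... | inj₂ (_ , reducedʳ red (equation e′)) =
    bounded-weaken [ inj₁ , inj₂ ∘ inj₂ ∘ >-≥-trans T>U ]′
      (unoriented OS (OT ∘ inj₂ ∘ >-≥-trans T>U) (acc rs) (rt T>U) e′ C σ refl refl) ◅◅
    bounded-weaken inj₂ (bounded-sym (oriented-reduction (OT (inj₁ refl)) red′))
    where
    red′ = reduction-instance C σ red
    T>U  = reduction-> red′

  -- The three hypotheses are those of the lexicographic induction: smaller source, same source with
  -- lower rank, same source and rank with smaller target.
  oriented-step : ∀ {S T k s t} → (∀ {S′} → S > S′ → OrientedAt S′) →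
    (∀ {T′ k′ l t′} → rank l k′ ⊏ rank s k → Oriented S T′ k′ l t′) →
    (∀ {T′ t′} → T > T′ → Oriented S T′ k s t′) →
    Oriented S T k s t
  oriented-step below lower smaller item C σ refl refl S>T with item-fate item
  ... | inj₁ persistent = (inj₁ refl , inj₂ S>T , limit-step C σ persistent) ◅ ε
  -- Same instance and same left side, but now a rule: only the kind drops.
  ... | inj₂ (_ , oriented→ {s} r _) = lower (rule-⊏-equation s) (rule r) C σ refl refl S>T
  ... | inj₂ (_ , oriented← _ t>s) = ⊥-elim (>-asym S>T (context-closed C (subst-closed σ t>s)))
  ... | inj₂ (_ , deleted) = ⊥-elim (>-irrefl refl S>T)
  ... | inj₂ (_ , reducedˡ red e) =
    -- From `S` to its reduct leads an instance of the reducing item, of lower rank. The remaining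
    -- equation relates two terms strictly below `S`.
    lower allowed item′ C′ ρ s≡ u≡ S>U ◅◅
    bounded-weaken (inj₂ ∘ [ >-≥-trans S>U , >-≥-trans S>T ]′)
      (unoriented (λ U≥W → below (>-≥-trans S>U U≥W)) (λ T≥W → below (>-≥-trans S>T T≥W))
                  (wellFounded _) (wellFounded _) e C σ refl refl)
    where
    red′ = reduction-instance C σ red
    S>U  = reduction-> red′
    open Reduction red′ renaming (item to item′; C to C′)
  ... | inj₂ (_ , reducedʳ red item′) =
    -- The rank stays and the target shrinks; the reduction of `T` starts strictly below `S`.
    smaller T>U item′ C σ refl refl (>-trans S>T T>U) ◅◅
    bounded-weaken (inj₂ ∘ >-≥-trans S>T) (bounded-sym (oriented-reduction (below S>T) red′))
    where
    red′ = reduction-instance C σ red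
    T>U  = reduction-> red′

  oriented-acc : ∀ {S T k s t} → Acc (flip _>_) S → Acc _⊏_ (rank s k) → Acc (flip _>_) T →
                 Oriented S T k s t
  oriented-acc (acc rs) (acc rk) (acc rt) = oriented-step
    (λ S>S′ → oriented-acc (rs S>S′) (⊏-wellFounded _) (wellFounded _))
    (λ l⊏s → oriented-acc (acc rs) (rk l⊏s) (wellFounded _))
    (λ T>T′ → oriented-acc (acc rs) (acc rk) (rt T>T′))

  oriented : ∀ {S} → OrientedAt S
  oriented = oriented-acc (wellFounded _) (⊏-wellFounded _) (wellFounded _)

  equation-bounded : ∀ {i s t} → (E i ±) s t → ∀ C σ →
    let S = C [ s ⟨ σ ⟩ ]; T = C [ t ⟨ σ ⟩ ] in Bounded Limit (λ w → S ≥ w ⊎ T ≥ w) S T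
  equation-bounded e C σ =
    unoriented (λ _ → oriented) (λ _ → oriented) (wellFounded _) (wellFounded _) e C σ refl refl

  -- Soundness of the inferences and equality of the conversion relations.

  ordered-step-sound : ∀ {X Y : Rel (Term F V) 0ℓ} → X ⇒ Y → Step (Ordered _>_ X) ⇒ Conversion Y
  ordered-step-sound X⊆Y (step (ordered e σ refl refl _) C ρ refl refl) =
    Star.return (Sym.gmap (λ t → C [ t ⟨ σ ⟩ ⟨ ρ ⟩ ])
      (step-[] C ∘ step-⟨⟩ ρ ∘ step-⟨⟩ σ ∘ step-base ∘ X⊆Y) e)

  orderedStep▷-sound : ∀ {X Y : Rel (Term F V) 0ℓ} → X ⇒ Y → OrderedStep▷ _>_ X ⇒ Conversion Y
  orderedStep▷-sound X⊆Y (step e C σ refl refl _ _) =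
    Star.return (Sym.gmap (λ t → C [ t ⟨ σ ⟩ ]) (step-[] C ∘ step-⟨⟩ σ ∘ step-base ∘ X⊆Y) e)

  step-sound : ∀ {X Y : Rel (Term F V) 0ℓ} → X ⇒ Y → Step X ⇒ Conversion Y
  step-sound X⊆Y = Eq.return ∘ step-map X⊆Y

  module _ {X : Rel (Term F V) 0ℓ} where

    base : X ⇒ Conversion X
    base = Eq.return ∘ step-base

    infix 6 _⁻¹
    _⁻¹ : ∀ {s t} → Conversion X s t → Conversion X t s
    _⁻¹ = Eq.symmetric _

  inference-sound : ∀ {Ẽ R̃ Ẽ′ R̃′} → _⊢_ _>_ (Ẽ , R̃) (Ẽ′ , R̃′) → (Ẽ′ ∪ R̃′) ⇒ Conversion (Ẽ ∪ R̃)
  inference-sound (deduce u→s u→t) (inj₁ (inj₁ e)) = base (inj₁ e)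
  inference-sound (deduce u→s u→t) (inj₁ (inj₂ (refl , refl))) = peak u→s ⁻¹ ◅◅ peak u→t
    where
    peak : ∀ {E R : Rel (Term F V) 0ℓ} → Step (R ∪ E ±) ⇒ Conversion (E ∪ R)
    peak (step (inj₁ r) C σ refl refl) = Eq.return (step (inj₂ r) C σ refl refl)
    peak (step (inj₂ e) C σ refl refl) =
      Star.return (Sym.gmap (λ t → C [ t ⟨ σ ⟩ ]) (λ e → step (inj₁ e) C σ refl refl) e)
  inference-sound (deduce u→s u→t) (inj₂ r)                  = base (inj₂ r)
  inference-sound (orientˡ _ _)   (inj₁ e)                    = base (inj₁ (inj₁ e))
  inference-sound (orientˡ _ _)   (inj₂ (inj₁ r))             = base (inj₂ r)
  inference-sound (orientˡ _ _)   (inj₂ (inj₂ (refl , refl))) = base (inj₁ (inj₂ (refl , refl)))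
  inference-sound (orientʳ _ _)   (inj₁ e)                    = base (inj₁ (inj₁ e))
  inference-sound (orientʳ _ _)   (inj₂ (inj₁ r))             = base (inj₂ r)
  inference-sound (orientʳ _ _)   (inj₂ (inj₂ (refl , refl))) = base (inj₁ (inj₂ (refl , refl))) ⁻¹
  inference-sound (delete _)      (inj₁ e)                    = base (inj₁ (inj₁ e))
  inference-sound (delete _)      (inj₂ r)                    = base (inj₂ r)
  inference-sound (compose _ _)   (inj₁ e)                    = base (inj₁ e)
  inference-sound (compose _ _)   (inj₂ (inj₁ r))             = base (inj₂ (inj₁ r))
  inference-sound (compose _ (step (inj₁ o) C σ eq₁ eq₂)) (inj₂ (inj₂ (refl , refl))) =
    base (inj₂ (inj₂ (refl , refl))) ◅◅ ordered-step-sound inj₁ (step o C σ eq₁ eq₂)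
  inference-sound (compose _ (step (inj₂ r) C σ eq₁ eq₂)) (inj₂ (inj₂ (refl , refl))) =
    base (inj₂ (inj₂ (refl , refl))) ◅◅ Eq.return (step (inj₂ (inj₁ r)) C σ eq₁ eq₂)
  inference-sound (simplifyˡ _ _) (inj₁ (inj₁ e))             = base (inj₁ (inj₁ e))
  inference-sound (simplifyˡ _ s→u) (inj₁ (inj₂ (refl , refl))) =
    [ step-sound inj₂ , orderedStep▷-sound (inj₁ ∘ inj₁) ]′ s→u ⁻¹ ◅◅ base (inj₁ (inj₂ (refl , refl)))
  inference-sound (simplifyˡ _ _) (inj₂ r)                    = base (inj₂ r)
  inference-sound (simplifyʳ _ _) (inj₁ (inj₁ e))             = base (inj₁ (inj₁ e))
  inference-sound (simplifyʳ _ t→u) (inj₁ (inj₂ (refl , refl))) =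
    base (inj₁ (inj₂ (refl , refl))) ◅◅ [ step-sound inj₂ , orderedStep▷-sound (inj₁ ∘ inj₁) ]′ t→u
  inference-sound (simplifyʳ _ _) (inj₂ r)                    = base (inj₂ r)
  inference-sound (collapse _ _)  (inj₁ (inj₁ e))             = base (inj₁ e)
  inference-sound (collapse _ t→u) (inj₁ (inj₂ (refl , refl))) =
    [ step-sound (inj₂ ∘ inj₁ ∘ proj₁) , orderedStep▷-sound inj₁ ]′ t→u ⁻¹ ◅◅ base (inj₂ (inj₂ (refl , refl)))
  inference-sound (collapse _ _)  (inj₂ r)                    = base (inj₂ (inj₁ r))

  state-sound : ∀ i → (E i ∪ R i) ⇒ Conversion (E 0)
  state-sound zero    (inj₁ e) = base e
  state-sound zero    (inj₂ r) = ⊥-elim (R₀-empty r)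
  state-sound (suc i) x with run i
  ... | _ , _ , ((_ , E←) , (_ , R←)) , st , ((_ , E′←) , (_ , R′←)) =
    conversion-extend (state-sound i ∘ [ inj₁ ∘ E← , inj₂ ∘ R← ]′)
      (inference-sound st ([ inj₁ ∘ E′← , inj₂ ∘ R′← ]′ x))

  limit-sound : Conversion Limit ⇒ Conversion (E 0)
  limit-sound = conversion-extend λ where
    (inj₁ (i , e)) → state-sound i (inj₁ (e i ≤-refl))
    (inj₂ (i , r)) → state-sound i (inj₂ (r i ≤-refl))

  limit-complete : Conversion (E 0) ⇒ Conversion Limit
  limit-complete = conversion-extend λ {s} {t} e →
    subst₂ (Conversion Limit) (⟨var⟩ s) (⟨var⟩ t) (bounded-conversion (equation-bounded (fwd e) □ var))

-- Rewriting in arguments and in substitutions.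

module _ {F : Signature} {V : Set} where

  ≡⇒star : ∀ {T : Rel (Term F V) 0ℓ} {s t} → s ≡ t → Star T s t
  ≡⇒star refl = ε

  -- Arguments are rewritten from left to right; abstracting `app f` to `K` lets it absorb those
  -- already done.
  star-arguments : ∀ {T : Rel (Term F V) 0ℓ} {n} (K : Vec (Term F V) n → Term F V) →
    (∀ ts i {s t} → T s t → T (K (ts [ i ]≔ s)) (K (ts [ i ]≔ t))) →
    ∀ {ts us} → (∀ i → Star T (lookup ts i) (lookup us i)) → Star T (K ts) (K us)
  star-arguments K closed {[]}     {[]}     steps = ε
  star-arguments K closed {t ∷ ts} {u ∷ us} steps =
    Star.gmap (λ v → K (v ∷ ts)) (closed (t ∷ ts) zero) (steps zero) ◅◅
    star-arguments (K ∘ (u ∷_)) (λ ts i → closed (u ∷ ts) (suc i)) (steps ∘ suc)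

  overwrite : ∀ {n} {ts us : Vec (Term F V) n} i {s} → ts ≡ us [ i ]≔ s →
              ∀ t → ts [ i ]≔ t ≡ us [ i ]≔ t
  overwrite {us = us} i refl t = []≔-idempotent us i

  module _ {X : Rel (Term F V) 0ℓ} where

    star-app : ∀ {f} {ts us : Vec (Term F V) (arity F f)} →
               (∀ i → Star (Step X) (lookup ts i) (lookup us i)) → Star (Step X) (app f ts) (app f us)
    star-app = star-arguments (app _) (λ ts i → step-[] (inside _ ts i □))

    mutual
      star-⟨⟩-pointwise : ∀ t {σ τ} → (∀ x → Star (Step X) (σ x) (τ x)) → Star (Step X) (t ⟨ σ ⟩) (t ⟨ τ ⟩)
      star-⟨⟩-pointwise (var x)    steps = steps x
      star-⟨⟩-pointwise (app f ts) steps = star-app (star-⟨⟩*-pointwise ts steps)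

      star-⟨⟩*-pointwise : ∀ {n} (ts : Vec (Term F V) n) {σ τ} → (∀ x → Star (Step X) (σ x) (τ x)) →
                           ∀ i → Star (Step X) (lookup (ts ⟨ σ ⟩*) i) (lookup (ts ⟨ τ ⟩*) i)
      star-⟨⟩*-pointwise (t ∷ ts) steps zero    = star-⟨⟩-pointwise t steps
      star-⟨⟩*-pointwise (t ∷ ts) steps (suc i) = star-⟨⟩*-pointwise ts steps i

    -- The hole of `C` lies either at a non-variable position of `l` or inside `ρ x`. In the second
    -- case `x` may occur elsewhere in `l`, so a step at the hole must be followed by steps at the
    -- other occurrences before an instance of `l` is reached again.
    data Decomposition (l : Term F V) (ρ : Subst {F} {V}) (C : Context {F} {V}) (s : Term F V) : Set where
      at-position  : (p : Position l) → NonVar (l ∣ p) → (l ∣ p) ⟨ ρ ⟩ ≡ s →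
                 (∀ t → contextAt l p ⟨ ρ ⟩ᶜ [ t ] ≡ C [ t ]) → Decomposition l ρ C s
      below-variable : (x : V) (D : Context {F} {V}) → ρ x ≡ D [ s ] →
                 (∀ t ρ′ → ρ′ x ≡ D [ t ] → (∀ y → Star (Step X) (ρ y) (ρ′ y)) →
                  Star (Step X) (C [ t ]) (l ⟨ ρ′ ⟩)) →
                 Decomposition l ρ C s

    decompose : ∀ l {ρ} C {s} → l ⟨ ρ ⟩ ≡ C [ s ] → Decomposition l ρ C s
    decompose (var x)    C eq = below-variable x C eq λ t ρ′ ρ′x _ → ≡⇒star (sym ρ′x)
    decompose (app f ts) □ eq = at-position root nonVar eq λ t → refl
    decompose (app f ts) {ρ} (inside g us i C) {s} eq with symbol-≡ eq
    ... | refl = extend (decompose (lookup ts i) C (trans (sym (lookup-⟨⟩* ts i))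
                   (trans (cong (λ vs → lookup vs i) args) (lookup∘update i us _))))
      where
      args : ts ⟨ ρ ⟩* ≡ us [ i ]≔ C [ s ]
      args = app-injective-args eq

      extend : Decomposition (lookup ts i) ρ C s → Decomposition (app f ts) ρ (inside f us i C) s
      extend (at-position p nv eq′ fill) = at-position (arg i p) nv eq′
        λ t → cong (app f) (trans (overwrite i args _) (cong (us [ i ]≔_) (fill t)))
      extend (below-variable x D ρx rewrites) = below-variable x D ρx λ t ρ′ ρ′x steps →
        star-app λ j → argument t ρ′ ρ′x steps j
        where
        argument : ∀ t ρ′ → ρ′ x ≡ D [ t ] → (∀ y → Star (Step X) (ρ y) (ρ′ y)) →
                   ∀ j → Star (Step X) (lookup (us [ i ]≔ C [ t ]) j) (lookup (ts ⟨ ρ′ ⟩*) j)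
        -- Argument `i` contains the hole; the others are still instances under `ρ`.
        argument t ρ′ ρ′x steps j with j ≟ᶠ i
        ... | yes refl = ≡⇒star (lookup∘update i us _) ◅◅ rewrites t ρ′ ρ′x steps ◅◅ ≡⇒star (sym (lookup-⟨⟩* ts i))
        ... | no j≢i   = ≡⇒star (trans (lookup∘update′ j≢i us _)
            (trans (sym (lookup∘update′ j≢i us _)) (cong (λ vs → lookup vs j) (sym args))))
          ◅◅ star-⟨⟩*-pointwise ts steps j

-- Critical peaks and local connectedness.

module CriticalPairs {F : Signature} {V : Set} (em : ExcludedMiddle 0ℓ) (inf : Infinite V)
  {_>_ : Rel (Term F V) 0ℓ} (ord : IsReductionOrder _>_)
  (E R : ℕ → Rel (Term F V) 0ℓ) (run : IsRun _>_ E R) (R₀-empty : Empty (R 0))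
  (fair : Fair _>_ E R) where

  open OrderProperties ord
  open Persistence em ord E R run R₀-empty
  open Unification {F} {V} em
  open Renaming em inf

  -- Treats persistent rules as equations, as critical pairs do. Rules are decreasing and so never
  -- apply backwards, hence the rewrite relation is that of `Sω`.
  OrderedLimit : Rel (Term F V) 0ℓ
  OrderedLimit = Ordered _>_ Limit

  liminfR-> : liminf R ⇒ _>_
  liminfR-> (i , r) = rules-> i (r i ≤-refl)

  Sω⇒ordered : Step (Sω _>_ E R) ⇒ Step OrderedLimit
  Sω⇒ordered = step-map λ where
    (inj₁ o) → ordered-map inj₁ o
    {s} {t} (inj₂ r) → ordered (fwd (inj₂ r)) var (sym (⟨var⟩ s)) (sym (⟨var⟩ t)) (liminfR-> r)

  orderedLimit⇒Sω : OrderedLimit ⇒ Step (Sω _>_ E R)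
  orderedLimit⇒Sω (ordered (fwd (inj₁ e)) σ eq₁ eq₂ s>t) = step-base (inj₁ (ordered (fwd e) σ eq₁ eq₂ s>t))
  orderedLimit⇒Sω (ordered (bwd (inj₁ e)) σ eq₁ eq₂ s>t) = step-base (inj₁ (ordered (bwd e) σ eq₁ eq₂ s>t))
  orderedLimit⇒Sω (ordered (fwd (inj₂ r)) σ eq₁ eq₂ s>t) = step (inj₂ r) □ σ eq₁ eq₂
  orderedLimit⇒Sω (ordered (bwd (inj₂ r)) σ refl refl s>t) =
    ⊥-elim (>-asym s>t (subst-closed σ (liminfR-> r)))

  ordered⇒Sω : Step OrderedLimit ⇒ Step (Sω _>_ E R)
  ordered⇒Sω (step o C σ refl refl) = step-[] C (step-⟨⟩ σ (orderedLimit⇒Sω o))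

  orderedLimit-⟨⟩ : ∀ σ {s t} → OrderedLimit s t → OrderedLimit (s ⟨ σ ⟩) (t ⟨ σ ⟩)
  orderedLimit-⟨⟩ σ (ordered {l} {r} e τ refl refl s>t) =
    ordered e (τ ⊙ σ) (⟨⟩-⊙ l) (⟨⟩-⊙ r) (subst-closed σ s>t)

  ordered-step-> : Step OrderedLimit ⇒ _>_
  ordered-step-> = step-> ordered->

  ordered⇒limit : Step OrderedLimit ⇒ SymClosure (Step Limit)
  ordered⇒limit (step (ordered e σ refl refl _) C ρ refl refl) =
    Sym.gmap (λ t → C [ t ⟨ ρ ⟩ ]) (step-[] C ∘ step-⟨⟩ ρ) (limit-step □ σ e)

  star-bounded : ∀ {u s t} → u > s → Star (Step OrderedLimit) s t → Bounded Limit (u >_) s t × u > t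
  star-bounded u>s ε         = ε , u>s
  star-bounded u>s (st ◅ sts) with star-bounded (>-trans u>s (ordered-step-> st)) sts
  ... | chain , u>t = (u>s , >-trans u>s (ordered-step-> st) , ordered⇒limit st) ◅ chain , u>t

  joinable-bounded : ∀ {u s t} → u > s → u > t → Joinable OrderedLimit s t → Bounded Limit (u >_) s t
  joinable-bounded u>s u>t (v , s→v , t→v) =
    proj₁ (star-bounded u>s s→v) ◅◅ bounded-sym (proj₁ (star-bounded u>t t→v))

  -- For a redex `s` this says that it is innermost; it is primality stated for the instance instead
  -- of the overlap.
  ArgumentsNormal : Term F V → Set
  ArgumentsNormal s = ∀ D {w} → D ≢ □ → s ≡ D [ w ] → IsNormalForm (Step OrderedLimit) w

  -- An overlap needs variable-disjoint variants, and unification a single substitution for both.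
  -- Renaming the first equation suffices.
  record CommonInstance (l₁ r₁ l₂ r₂ : Term F V) (σ₁ σ₂ : Subst {F} {V}) : Set where
    field
      π        : V ↔ V
      ρ        : Subst {F} {V}
      disjoint : ∀ x → x ∈ᵥ l₁ ⟨ var ∘ Inverse.to π ⟩ ⊎ x ∈ᵥ r₁ ⟨ var ∘ Inverse.to π ⟩ → ¬ (x ∈ᵥ l₂ ⊎ x ∈ᵥ r₂)
      l₁≡      : l₁ ⟨ var ∘ Inverse.to π ⟩ ⟨ ρ ⟩ ≡ l₁ ⟨ σ₁ ⟩
      r₁≡      : r₁ ⟨ var ∘ Inverse.to π ⟩ ⟨ ρ ⟩ ≡ r₁ ⟨ σ₁ ⟩
      l₂≡      : l₂ ⟨ ρ ⟩ ≡ l₂ ⟨ σ₂ ⟩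
      r₂≡      : r₂ ⟨ ρ ⟩ ≡ r₂ ⟨ σ₂ ⟩

  commonInstance : ∀ l₁ r₁ l₂ r₂ σ₁ σ₂ → CommonInstance l₁ r₁ l₂ r₂ σ₁ σ₂
  commonInstance l₁ r₁ l₂ r₂ σ₁ σ₂ = record
    { π        = π
    ; ρ        = ρ
    ; disjoint = disjoint
    ; l₁≡      = renamed l₁ (∈-++⁺ˡ ∘ ∈-vars)
    ; r₁≡      = renamed r₁ (∈-++⁺ʳ (vars l₁) ∘ ∈-vars)
    ; l₂≡      = ⟨⟩-cong l₂ λ x x∈ → ρ-second (inj₁ x∈)
    ; r₂≡      = ⟨⟩-cong r₂ λ x x∈ → ρ-second (inj₂ x∈)
    }
    where
    apart = renaming-apart (vars l₁ ++ vars r₁) (vars l₂ ++ vars r₂)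
    π     = proj₁ apart
    open Inverse π using (to; from; strictlyInverseʳ)

    Second : V → Set
    Second x = x ∈ᵥ l₂ ⊎ x ∈ᵥ r₂

    Second⇒∈ : ∀ {x} → Second x → x ∈ vars l₂ ++ vars r₂
    Second⇒∈ (inj₁ x∈) = ∈-++⁺ˡ (∈-vars x∈)
    Second⇒∈ (inj₂ x∈) = ∈-++⁺ʳ (vars l₂) (∈-vars x∈)

    ρ : Subst
    -- Disjointness lets both substitutions fit into one; outside the second equation, variables are
    -- read back through the renaming.
    ρ x with em {Second x}
    ... | yes _ = σ₂ x
    ... | no _  = σ₁ (from x)

    ρ-second : ∀ {x} → Second x → ρ x ≡ σ₂ x
    ρ-second {x} x∈ with em {Second x}
    ... | yes _ = refl
    ... | no x∉ = ⊥-elim (x∉ x∈)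

    ρ-first : ∀ {x} → x ∈ vars l₁ ++ vars r₁ → ρ (to x) ≡ σ₁ x
    ρ-first {x} x∈ with em {Second (to x)}
    ... | yes second = ⊥-elim (proj₂ apart x x∈ (Second⇒∈ second))
    ... | no _       = cong σ₁ (strictlyInverseʳ x)

    renamed : ∀ t → (∀ {x} → x ∈ᵥ t → x ∈ vars l₁ ++ vars r₁) → t ⟨ var ∘ to ⟩ ⟨ ρ ⟩ ≡ t ⟨ σ₁ ⟩
    renamed t t⊆ = trans (⟨⟩-⊙ t) (⟨⟩-cong t λ x x∈ → ρ-first (t⊆ x∈))

    from-first : ∀ t → (∀ {x} → x ∈ᵥ t → x ∈ vars l₁ ++ vars r₁) → ∀ {y} → y ∈ᵥ t ⟨ var ∘ to ⟩ → ¬ Second y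
    from-first t t⊆ y∈ second with ∈ᵥ-⟨⟩⁻ t y∈
    ... | x , x∈ , here = proj₂ apart x (t⊆ x∈) (Second⇒∈ second)

    disjoint : ∀ x → x ∈ᵥ l₁ ⟨ var ∘ to ⟩ ⊎ x ∈ᵥ r₁ ⟨ var ∘ to ⟩ → ¬ Second x
    disjoint x (inj₁ x∈) = from-first l₁ (∈-++⁺ˡ ∘ ∈-vars) x∈
    disjoint x (inj₂ x∈) = from-first r₁ (∈-++⁺ʳ (vars l₁) ∘ ∈-vars) x∈

  -- A joining valley descends from terms below `u`, and an `⋃ E` step becomes a limit conversion
  -- bounded by its ends; instantiation preserves both.
  fair-instance : ∀ {s t} θ {u} → u > s ⟨ θ ⟩ → u > t ⟨ θ ⟩ → PCP _>_ Limit s t →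
                  Bounded Limit (u >_) (s ⟨ θ ⟩) (t ⟨ θ ⟩)
  fair-instance θ {u} u>s u>t pcp with fair pcp
  ... | inj₁ (v , s→v , t→v) = joinable-bounded u>s u>t (v ⟨ θ ⟩ , instances s→v , instances t→v)
    where
    instances : ∀ {a b} → Star (Step (Sω _>_ E R)) a b → Star (Step OrderedLimit) (a ⟨ θ ⟩) (b ⟨ θ ⟩)
    instances = Star.gmap (_⟨ θ ⟩) (step-⟨⟩ θ ∘ Sω⇒ordered)
  ... | inj₂ e = bounded-⟨⟩ θ [ below u>s , below u>t ]′ (limit-bounded e)
    where
    below : ∀ {a w} → u > a ⟨ θ ⟩ → a ≥ w → u > w ⟨ θ ⟩
    below u>a (inj₁ refl) = u>a
    below u>a (inj₂ a>w)  = >-trans u>a (subst-closed θ a>w)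

    limit-bounded : ∀ {s t} → SymClosure (Step (⋃ E)) s t → Bounded Limit (λ w → s ≥ w ⊎ t ≥ w) s t
    limit-bounded (fwd (step (_ , e) C σ refl refl)) = equation-bounded (fwd e) C σ
    limit-bounded (bwd (step (_ , e) C σ refl refl)) = equation-bounded (bwd e) C σ

  -- If `s` sits at a non-variable position of `l₂`, the peak is an instance of an extended critical
  -- pair. The order conditions hold because a reversed inequality would survive instantiation and
  -- contradict the peak.
  critical-peak : ∀ {s s′ t t′} C → OrderedLimit s s′ → ArgumentsNormal s → OrderedLimit t t′ →
                  t ≡ C [ s ] → Bounded Limit (t >_) (C [ s′ ]) t′
  critical-peak {s} {s′} {t} {t′} C (ordered {l₁} {r₁} e₁ σ₁ s≡ s′≡ s>s′) s-normal
    (ordered {l₂} {r₂} e₂ σ₂ t≡ t′≡ t>t′) t≡C[s] =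
    from-decomposition (decompose l₂ C (trans l₂ρ≡t t≡C[s]))
    where
    open CommonInstance (commonInstance l₁ r₁ l₂ r₂ σ₁ σ₂)

    rename : Term F V → Term F V
    rename u = u ⟨ var ∘ Inverse.to π ⟩

    l₁ρ≡s  = trans l₁≡ (sym s≡)
    r₁ρ≡s′ = trans r₁≡ (sym s′≡)
    l₂ρ≡t  = trans l₂≡ (sym t≡)
    r₂ρ≡t′ = trans r₂≡ (sym t′≡)

    t>C[s′] : t > (C [ s′ ])
    t>C[s′] = subst (_> (C [ s′ ])) (sym t≡C[s]) (context-closed C s>s′)

    from-decomposition : Decomposition {X = OrderedLimit} l₂ ρ C s → Bounded Limit (t >_) (C [ s′ ]) t′
    from-decomposition (below-variable x D ρx≡ rewrites) =
      -- Under `ρ′` the sides of the second equation need not be ordered any more, so the middle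
      -- step is only a limit step; both of its ends are below `t`.
      proj₁ left ◅◅ (proj₂ left , proj₂ right , limit-step □ ρ′ e₂) ◅ bounded-sym (proj₁ right)
      where
      ρ′ : Subst
      ρ′ y with em {y ≡ x}
      ... | yes _ = D [ s′ ]
      ... | no _  = ρ y

      ρ′x≡ : ρ′ x ≡ D [ s′ ]
      ρ′x≡ with em {x ≡ x}
      ... | yes _  = refl
      ... | no x≢x = ⊥-elim (x≢x refl)

      ρ→ρ′ : ∀ y → Star (Step OrderedLimit) (ρ y) (ρ′ y)
      ρ→ρ′ y with em {y ≡ x}
      ... | yes refl = ≡⇒star ρx≡ ◅◅ step-[] D (step-base (ordered e₁ σ₁ s≡ s′≡ s>s′)) ◅ ε
      ... | no _     = ε

      left  = star-bounded t>C[s′] (rewrites s′ ρ′ ρ′x≡ ρ→ρ′)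
      right = star-bounded t>t′ (≡⇒star (sym r₂ρ≡t′) ◅◅ star-⟨⟩-pointwise r₂ ρ→ρ′)
    from-decomposition (at-position p nv l₂∣pρ≡s fill)
      with mgu-exists {rename l₁} {l₂ ∣ p} ρ (trans l₁ρ≡s (sym l₂∣pρ≡s))
    ... | μ , mgu with IsMGU.mostGeneral mgu ρ (trans l₁ρ≡s (sym l₂∣pρ≡s))
    ... | θ , ρ≡μθ = subst₂ (Bounded Limit (t >_)) left≡ right≡
      (fair-instance θ (subst (t >_) (sym left≡) t>C[s′]) (subst (t >_) (sym right≡) t>t′)
        (extended-overlap , prime , refl , refl))
      where
      factor : ∀ u → u ⟨ μ ⟩ ⟨ θ ⟩ ≡ u ⟨ ρ ⟩
      factor u = trans (⟨⟩-⊙ u) (⟨⟩-cong u λ x _ → sym (ρ≡μθ x))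

      left≡ : replaceAt l₂ p (rename r₁) ⟨ μ ⟩ ⟨ θ ⟩ ≡ C [ s′ ]
      left≡ = trans (factor (replaceAt l₂ p (rename r₁))) (trans (replaceAt-⟨⟩ l₂ p)
        (trans (fill (rename r₁ ⟨ ρ ⟩)) (cong (C [_]) r₁ρ≡s′)))

      right≡ : r₂ ⟨ μ ⟩ ⟨ θ ⟩ ≡ t′
      right≡ = trans (factor r₂) r₂ρ≡t′

      inner≡ : rename l₁ ⟨ μ ⟩ ⟨ θ ⟩ ≡ s
      inner≡ = trans (factor (rename l₁)) l₁ρ≡s

      extended-overlap : ExtendedOverlap _>_ Limit
      extended-overlap = record
        { l₁ = rename l₁ ; r₁ = rename r₁ ; l₂ = l₂ ; r₂ = r₂
        ; variant₁ = l₁ , r₁ , e₁ , π , refl , refl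
        ; variant₂ = l₂ , r₂ , e₂ , ↔-id V , sym (⟨var⟩ l₂) , sym (⟨var⟩ r₂)
        ; disjoint = disjoint
        ; p = p ; p-nonVar = nv ; μ = μ ; mgu = mgu
        ; r₁≯l₁ = λ r>l → >-asym s>s′ (subst₂ _>_ (trans (factor (rename r₁)) r₁ρ≡s′) inner≡ (subst-closed θ r>l))
        ; r₂≯l₂ = λ r>l → >-asym t>t′ (subst₂ _>_ right≡ (trans (factor l₂) l₂ρ≡t) (subst-closed θ r>l))
        }

      prime : ExtendedOverlap.Prime extended-overlap
      -- A reducible proper subterm of the unified left side would, instantiated by `θ`, be a
      -- reducible proper subterm of `s`.
      prime q q≢root (w , st) = s-normal (contextAt (rename l₁ ⟨ μ ⟩) q ⟨ θ ⟩ᶜ) (⟨⟩ᶜ≢□ (contextAt≢□ q≢root))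
        (trans (sym inner≡) (trans (cong _⟨ θ ⟩ (sym (contextAt-∣ (rename l₁ ⟨ μ ⟩) q))) ([]-⟨⟩ (contextAt (rename l₁ ⟨ μ ⟩) q))))
        (w ⟨ θ ⟩ , step-⟨⟩ θ st)

  -- The common part of the two contexts is stripped. Then the redex `t` contains `s`, or lies
  -- properly inside `s`, which innermostness forbids, or the redexes are parallel and the steps
  -- commute.
  innermost-peak : ∀ C D {s s′ t t′} → OrderedLimit s s′ → ArgumentsNormal s → OrderedLimit t t′ →
                   C [ s ] ≡ D [ t ] → Bounded Limit ((C [ s ]) >_) (C [ s′ ]) (D [ t′ ])
  innermost-peak C □ s→s′ s-normal t→t′ refl = critical-peak C s→s′ s-normal t→t′ refl
  innermost-peak □ D@(inside _ _ _ _) s→s′ s-normal t→t′ eq =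
    ⊥-elim (s-normal D (λ ()) eq (_ , step-base t→t′))
  innermost-peak (inside f ts i C) (inside g us j D) {s} {s′} {t} {t′} s→s′ s-normal t→t′ eq with symbol-≡ eq
  ... | refl = by-cases (j ≟ᶠ i)
    where
    -- The actual arguments of the peak; both reducts are rephrased as updates of `vs`, so that
    -- updates at different indices commute.
    vs = ts [ i ]≔ C [ s ]
    u  = app f vs

    vs≡ : vs ≡ us [ j ]≔ D [ t ]
    vs≡ = app-injective-args eq

    left≡ : app f (vs [ i ]≔ C [ s′ ]) ≡ inside f ts i C [ s′ ]
    left≡ = cong (app f) ([]≔-idempotent ts i)

    right≡ : app f (vs [ j ]≔ D [ t′ ]) ≡ inside f us j D [ t′ ]
    right≡ = cong (app f) (overwrite j vs≡ _)

    vs[j] : vs [ j ]≔ D [ t ] ≡ vs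
    vs[j] = trans (overwrite j vs≡ _) (sym vs≡)

    by-cases : Dec (j ≡ i) → Bounded Limit (u >_) (inside f ts i C [ s′ ]) (inside f us j D [ t′ ])
    by-cases (yes refl) = subst₂ (Bounded Limit (u >_)) left≡ right≡
      (bounded-[] (inside f vs i □) bound (innermost-peak C D s→s′ s-normal t→t′ C[s]≡D[t]))
      where
      C[s]≡D[t] : C [ s ] ≡ D [ t ]
      C[s]≡D[t] = trans (sym (lookup∘update i ts _)) (trans (cong (λ ws → lookup ws i) vs≡) (lookup∘update i us _))

      bound : ∀ {w} → (C [ s ]) > w → u > app f (vs [ i ]≔ w)
      bound {w} C[s]>w = subst (_> app f (vs [ i ]≔ w)) (cong (app f) ([]≔-idempotent ts i)) (context-closed (inside f vs i □) C[s]>w)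
    by-cases (no j≢i) = subst₂ (Bounded Limit (u >_)) left≡ right≡
      (joinable-bounded u>left u>right (app f (vs [ i ]≔ C [ s′ ] [ j ]≔ D [ t′ ]) , left-step ◅ ε , right-step ◅ ε))
      where
      u>left : u > app f (vs [ i ]≔ C [ s′ ])
      u>left = subst (u >_) (sym left≡) (context-closed (inside f ts i C) (ordered-> s→s′))

      u>right : u > app f (vs [ j ]≔ D [ t′ ])
      u>right = subst (_> app f (vs [ j ]≔ D [ t′ ])) (cong (app f) vs[j]) (context-closed (inside f vs j D) (ordered-> t→t′))

      left-step : Step OrderedLimit (app f (vs [ i ]≔ C [ s′ ])) (app f (vs [ i ]≔ C [ s′ ] [ j ]≔ D [ t′ ]))
      left-step = subst (λ ws → Step OrderedLimit (app f ws) (app f (vs [ i ]≔ C [ s′ ] [ j ]≔ D [ t′ ])))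
        (trans ([]≔-commutes vs i j (j≢i ∘ sym)) (cong (_[ i ]≔ C [ s′ ]) vs[j]))
        (step-[] (inside f (vs [ i ]≔ C [ s′ ]) j D) (step-base t→t′))

      right-step : Step OrderedLimit (app f (vs [ j ]≔ D [ t′ ])) (app f (vs [ i ]≔ C [ s′ ] [ j ]≔ D [ t′ ]))
      right-step = subst₂ (λ ws ws′ → Step OrderedLimit (app f ws) (app f ws′))
        (trans ([]≔-commutes vs j i j≢i) (cong (_[ j ]≔ D [ t′ ]) ([]≔-idempotent ts i)))
        ([]≔-commutes vs j i j≢i)
        (step-[] (inside f (vs [ j ]≔ D [ t′ ]) i C) (step-base s→s′))

  -- Excluded middle either certifies that all proper subterms of the redex are normal or yields a
  -- reducible one, where a strictly smaller redex is found.
  innermost : ∀ {u v} → Step OrderedLimit u v →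
              ∃ λ C → ∃ λ s → ∃ λ s′ → u ≡ C [ s ] × OrderedLimit s s′ × ArgumentsNormal s
  innermost {v = v} (step {l} {r} o C σ refl refl) = search (<-wellFounded _) C (orderedLimit-⟨⟩ σ o)
    where
    search : ∀ {s s′} → Acc _<_ (size s) → ∀ C → OrderedLimit s s′ →
             ∃ λ D → ∃ λ t → ∃ λ t′ → (C [ s ]) ≡ D [ t ] × OrderedLimit t t′ × ArgumentsNormal t
    search {s} (acc rs) C o with em {∃ λ D → ∃ λ w → D ≢ □ × s ≡ D [ w ] × ∃ (Step OrderedLimit w)}
    ... | no ¬reducible = C , s , _ , refl , o , λ D D≢□ eq st → ¬reducible (D , _ , D≢□ , eq , st)
    ... | yes (D , _ , D≢□ , refl , _ , step {l} o′ D′ σ refl refl)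
      with search (rs (≤-<-trans (size-fill D′ {l ⟨ σ ⟩}) (size-fill-< {C = D} D≢□))) (C ∘ᶜ D ∘ᶜ D′) (orderedLimit-⟨⟩ σ o′)
    ... | C″ , t , t′ , eq , rest =
      C″ , t , t′ , trans (sym (trans (∘ᶜ-[] C (D ∘ᶜ D′)) (cong (C [_]) (∘ᶜ-[] D D′)))) eq , rest

  local-confluence : ∀ {u v w} → Step OrderedLimit u v → Step OrderedLimit u w → Bounded Limit (u >_) v w
  local-confluence u→v u→w with innermost u→v
  ... | C , s , s′ , refl , s→s′ , s-normal = bounded-sym (from u→v) ◅◅ from u→w
    where
    from : ∀ {v} → Step OrderedLimit (C [ s ]) v → Bounded Limit ((C [ s ]) >_) (C [ s′ ]) v
    from (step o D σ eq refl) = innermost-peak C D s→s′ s-normal (orderedLimit-⟨⟩ σ o) eq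

-- Ground terms.

module _ {F : Signature} {V : Set} where

  occurrence-context : ∀ {t : Term F V} {x} σ → x ∈ᵥ t → ∃ λ C → t ⟨ σ ⟩ ≡ C [ σ x ]
  occurrence-context σ here = □ , refl
  occurrence-context σ (there {f} {ts} i x∈) with occurrence-context σ x∈
  ... | C , eq = inside f (ts ⟨ σ ⟩*) i C , cong (app f)
    (sym (trans (cong (ts ⟨ σ ⟩* [ i ]≔_) (trans (sym eq) (sym (lookup-⟨⟩* ts i)))) ([]≔-lookup (ts ⟨ σ ⟩*) i)))

  ground-[]⁻ : ∀ C {t : Term F V} → Ground (C [ t ]) → Ground t
  ground-[]⁻ □                 g x x∈ = g x x∈
  ground-[]⁻ (inside f ts i C) {t} g x x∈ =
    ground-[]⁻ C (λ y y∈ → g y (there i (subst (y ∈ᵥ_) (sym (lookup∘update i ts _)) y∈))) x x∈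

  ground-⟨⟩ : ∀ {t : Term F V} {σ} → Ground t → t ⟨ σ ⟩ ≡ t
  ground-⟨⟩ {t} g = trans (⟨⟩-cong t λ x x∈ → ⊥-elim (g x x∈)) (⟨var⟩ t)

  ⟨const⟩-ground : ∀ (t : Term F V) {g : Term F V} → Ground g → Ground (t ⟨ const g ⟩)
  ⟨const⟩-ground t g x x∈ with ∈ᵥ-⟨⟩⁻ t x∈
  ... | _ , _ , x∈g = g x x∈g

-- Variable conditions implied by a reduction order.

module ReductionOrderVariables {F : Signature} {V : Set} (em : ExcludedMiddle 0ℓ)
  {_>_ : Rel (Term F V) 0ℓ} (ord : IsReductionOrder _>_) where

  open OrderProperties ord
  open Unification {F} {V} em

  -- Otherwise u > C[u] > C[C[u]] > ⋯ would be an infinite descent.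
  not-below-context : ∀ {u} C → ¬ (u > (C [ u ]))
  not-below-context {u} C = go (wellFounded u)
    where
    go : ∀ {u} → Acc (flip _>_) u → ¬ (u > (C [ u ]))
    go (acc rs) u>C[u] = go (rs u>C[u]) (context-closed C u>C[u])

  -- If `x` occurred in `t` but not in `s`, then `x ↦ s` would fix `s` and place a copy of it inside
  -- the instance of `t`.
  >-vars : ∀ {s t} → s > t → ∀ {x} → x ∈ᵥ t → x ∈ᵥ s
  >-vars {s} {t} s>t {x} x∈t with em {x ∈ᵥ s}
  ... | yes x∈s = x∈s
  ... | no x∉s with occurrence-context (x ↦ s) x∈t
  ...   | C , eq = ⊥-elim (not-below-context C (subst₂ _>_
    (trans (⟨⟩-cong s λ y y∈ → ↦-other s λ { refl → x∉s y∈ }) (⟨var⟩ s))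
    (trans eq (cong (C [_]) (↦-same x s))) (subst-closed (x ↦ s) s>t)))

  -- For `var x > t`, either `x` occurs in `t`, so `var x` exceeds a context around itself, or
  -- `x ↦ t` turns the inequality into `t > t`.
  >-nonVar : ∀ {s t} → s > t → NonVar s
  >-nonVar {app f ts} _   = nonVar
  >-nonVar {var x} {t} x>t with em {x ∈ᵥ t}
  ... | yes x∈t with occurrence-context var x∈t
  ...   | C , eq = ⊥-elim (not-below-context C (subst (var x >_) (trans (sym (⟨var⟩ t)) eq) x>t))
  >-nonVar {var x} {t} x>t | no x∉t = ⊥-elim (>-irrefl refl (subst₂ _>_ (↦-same x t)
    (trans (⟨⟩-cong t λ y y∈ → ↦-other t λ { refl → x∉t y∈ }) (⟨var⟩ t)) (subst-closed (x ↦ t) x>t)))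

  >-ground : ∀ {s t} → s > t → Ground s → Ground t
  >-ground s>t g x x∈ = g x (>-vars s>t x∈)

-- Ground confluence.

module GroundConfluence {F : Signature} {V : Set} (em : ExcludedMiddle 0ℓ) (inf : Infinite V)
  {_>_ : Rel (Term F V) 0ℓ} (ord : IsReductionOrder _>_) (total : GroundTotal _>_)
  (E R : ℕ → Rel (Term F V) 0ℓ) (run : IsRun _>_ E R) (R₀-empty : Empty (R 0))
  (fair : Fair _>_ E R) where

  open OrderProperties ord
  open ReductionOrderVariables em ord
  open Persistence em ord E R run R₀-empty
  open CriticalPairs em inf ord E R run R₀-empty fair

  -- The instances in the hole are subterms of ground terms, hence ground, so totality applies to
  -- them unless they coincide.
  orient-ground : ∀ {s t} → (Limit ±) s t → ∀ C σ → Ground (C [ s ⟨ σ ⟩ ]) → Ground (C [ t ⟨ σ ⟩ ]) →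
                  C [ s ⟨ σ ⟩ ] ≡ C [ t ⟨ σ ⟩ ] ⊎ SymClosure (Step OrderedLimit) (C [ s ⟨ σ ⟩ ]) (C [ t ⟨ σ ⟩ ])
  orient-ground {s} {t} e C σ gs gt with em {s ⟨ σ ⟩ ≡ t ⟨ σ ⟩}
  ... | yes eq = inj₁ (cong (C [_]) eq)
  ... | no s≢t with total (ground-[]⁻ C gs) (ground-[]⁻ C gt) s≢t
  ...   | inj₁ s>t = inj₂ (fwd (step-[] C (step-base (ordered e σ refl refl s>t))))
  ...   | inj₂ t>s = inj₂ (bwd (step-[] C (step-base (ordered (Sym.symmetric _ e) σ refl refl t>s))))

  orient-ground-step : ∀ {s t} → Ground s → Ground t → SymClosure (Step Limit) s t →
                       s ≡ t ⊎ SymClosure (Step OrderedLimit) s t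
  orient-ground-step gs gt (fwd (step e C σ refl refl)) = orient-ground (fwd e) C σ gs gt
  orient-ground-step gs gt (bwd (step e C σ refl refl)) = orient-ground (bwd e) C σ gs gt

  ConfluentAt : Term F V → Set
  ConfluentAt u = ∀ {s t} → Star (Step OrderedLimit) u s → Star (Step OrderedLimit) u t → Joinable OrderedLimit s t

  ConfluentBelow : Term F V → Set
  ConfluentBelow u = ∀ {w} → u > w → Ground w → ConfluentAt w

  -- The chain is folded into a valley from its far end: a forward step lengthens one leg, a
  -- backward step creates a peak at a term below `u`, where confluence is assumed.
  join-bounded : ∀ {u s t} → ConfluentBelow u → Bounded Limit (λ w → u > w × Ground w) s t → Joinable OrderedLimit s t
  join-bounded confluent ε = _ , ε , ε
  join-bounded confluent (((u>s , gs) , (u>w , gw) , st) ◅ chain)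
    with join-bounded confluent chain | orient-ground-step gs gw st
  ... | joined            | inj₁ refl      = joined
  ... | v , w→v , t→v     | inj₂ (fwd s→w) = v , s→w ◅ w→v , t→v
  ... | v , w→v , t→v     | inj₂ (bwd w→s) with confluent u>w gw (w→s ◅ ε) w→v
  ...   | v′ , s→v′ , v→v′ = v′ , s→v′ , t→v ◅◅ v→v′

  ground-local : ∀ {u v w} → Ground u → Step OrderedLimit u v → Step OrderedLimit u w →
                 Bounded Limit (λ x → u > x × Ground x) v w
  ground-local {u} gu u→v u→w = subst₂ (Bounded Limit _)
    (ground-⟨⟩ (>-ground (ordered-step-> u→v) gu)) (ground-⟨⟩ (>-ground (ordered-step-> u→w) gu))
    -- Putting `u` for every variable makes each term of the chain ground and fixes `u` and both
    -- ends, which are ground.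
    (bounded-⟨⟩ (const u) (λ {x} u>x → subst (_> (x ⟨ const u ⟩)) (ground-⟨⟩ gu) (subst-closed (const u) u>x)
                                    , ⟨const⟩-ground x gu)
      (local-confluence u→v u→w))

  -- Newman's lemma with joinability of local peaks weakened to connectedness below the source:
  -- `join-bounded` recovers joinability from the induction hypothesis.
  ground-confluent : ∀ {u} → Acc (flip _>_) u → Ground u → ConfluentAt u
  ground-confluent _ gu ε u→t = _ , u→t , ε
  ground-confluent _ gu (u→s ◅ s→s′) ε = _ , ε , u→s ◅ s→s′
  ground-confluent (acc rs) gu (u→s ◅ s→s′) (u→t ◅ t→t′)
    with join-bounded (λ u>w → ground-confluent (rs u>w)) (ground-local gu u→s u→t)
  ... | v , s→v , t→v
    with ground-confluent (rs (ordered-step-> u→s)) (>-ground (ordered-step-> u→s) gu) s→s′ s→v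
  ... | v₁ , s′→v₁ , v→v₁
    with ground-confluent (rs (ordered-step-> u→t)) (>-ground (ordered-step-> u→t) gu) (t→v ◅◅ v→v₁) t→t′
  ... | v₂ , v₁→v₂ , t′→v₂ = v₂ , s′→v₁ ◅◅ v₁→v₂ , t′→v₂

  Sω-> : Sω _>_ E R ⇒ _>_
  Sω-> = [ ordered-> , liminfR-> ]′

  ground-complete : GroundComplete (Sω _>_ E R)
  ground-complete = record
    { isTRS = record { lhs-nonVar = >-nonVar ∘ Sω-> ; rhs-vars = >-vars ∘ Sω-> }
    ; terminating = Subrelation.wellFounded (step-> Sω->) wellFounded
    ; groundConfluent = confluent
    }
    where
    confluent : ∀ {s t u} → Ground s → Ground t →
                Star (Step (Sω _>_ E R)) u s → Star (Step (Sω _>_ E R)) u t → Joinable (Sω _>_ E R) s t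
    confluent {s} {t} {u} gs gt u→s u→t
      -- The source `u` may contain variables. Replacing them all by the ground term `s` makes it
      -- ground, and both ends stay as they are.
      with ground-confluent (wellFounded (u ⟨ const s ⟩)) (⟨const⟩-ground u gs) (instances gs u→s) (instances gt u→t)
      where
      instances : ∀ {v} → Ground v → Star (Step (Sω _>_ E R)) u v → Star (Step OrderedLimit) (u ⟨ const s ⟩) v
      instances gv u→v = subst (Star _ _) (ground-⟨⟩ gv) (Star.gmap (_⟨ const s ⟩) (step-⟨⟩ (const s) ∘ Sω⇒ordered) u→v)
    ... | v , s→v , t→v = v , Star.map ordered⇒Sω s→v , Star.map ordered⇒Sω t→v

theorem7p16 : ExcludedMiddle 0ℓ →
    (F : Signature) (V : Set) → Infinite V →
    (_>_ : Rel (Term F V) 0ℓ) → IsReductionOrder _>_ → GroundTotal _>_ →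
    (E R : ℕ → Rel (Term F V) 0ℓ) → IsRun _>_ E R → Empty (R 0) →
    Fair _>_ E R →
    GroundComplete (Sω _>_ E R) ×
    (Conversion (E 0) ⇔ Conversion (liminf E ∪ liminf R))
theorem7p16 em F V inf _>_ ord total E R run R₀-empty fair =
  ground-complete , limit-complete , limit-sound
  where
  open Persistence em ord E R run R₀-empty
  open GroundConfluence em inf ord total E R run R₀-empty fair
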